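{- Let $G$ be a group, $(B,\|\cdot\|)$ a Banach representation of $G$ and $v\in B$ a non-zero vector. The following are equivalent. (1) $v$ is a strongly cyclic vector of $B$ and $\|\cdot\|=\|\cdot\|_{v,B}$. (2) Let $V$ be the (algebraic) sub-representation of $B$ generated by $v$, let $\widehat{V}$ be its universal unitary completion, and let $I:\widehat{V}\to B$ be the continuous map extending the inclusion $V\subset B$. Then $I$ is surjective and, if $K$ is its kernel, the induced map $\widehat{V}/K\to B$ is an isometry when $\widehat{V}$ is equipped with the norm $\|\cdot\|_v$ (and $\widehat V/K$ with the quotient norm). (3) $\|\cdot\|$ is normalized at $v$ and locally maximal at $v$.
   Context: All vector spaces are over $\mathbb{C}_p$ (completion of an algebraic closure of $\mathbb{Q}_p$, absolute value $|\cdot|_p$, ring of integers $\mathcal{O}_{\mathbb{C}_p}$), and norms are non-archimedean. $G$ is an abstract group. A norm is $G$-invariant if $\|gv\|=\|v\|$ for all $g\in G$. A Banach representation of $G$ is a pair $(B,\|\cdot\|)$ of a $G$-representation $B$ and a $G$-invariant norm for which $B$ is complete. $\|\cdot\|_1$ is dominated by $\|\cdot\|_2$ if $\|\cdot\|_1\le D\|\cdot\|_2$ for some $D>0$; the norms are equivalent if each dominates the other. A norm is normalized at $v$ if $\|v\|=1$. A $G$-invariant norm $\|\cdot\|$ on a representation $W$, normalized at a non-zero $w\in W$, is locally maximal at $w$ if every $G$-invariant norm $\|\cdot\|'$ on $W$ that is normalized at $w$ and dominated by $\|\cdot\|$ satisfies $\|\cdot\|'\le\|\cdot\|$. A family $(\lambda_g)_{g\in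 G}\subset\mathbb{C}_p$ is summable if for every $\epsilon>0$ only finitely many $g$ satisfy $|\lambda_g|_p\ge\epsilon$. A non-zero $v\in B$ is strongly cyclic if every $w\in B$ can be written as $w=\sum_{g\in G}\lambda_g\,g(v)$ with $(\lambda_g)$ summable. If $v$ is strongly cyclic in $(B,\|\cdot\|)$, there is a unique $G$-invariant norm on $B$ that is equivalent to $\|\cdot\|$, normalized at $v$ and locally maximal at $v$; it is denoted $\|\cdot\|_{v,B}$. Universal unitary completion: let $V$ be a representation of $G$ with (algebraic) cyclic vector $v$, admitting a $G$-invariant norm. Put $L_v=\mathcal{O}_{\mathbb{C}_p}[G]\cdot v$ and $\|w\|_v=\inf\{|a|_p: w\in aL_v\}$. This is the largest $G$-invariant norm on $V$ normalized at $v$. $\widehat{V}$ is the completion of $V$ with respect to $\|\cdot\|_v$; as a topological representation it does not depend on the cyclic vector, and every $G$-equivariant linear map from $V$ to a Banach representation of $G$ extends uniquely to a continuous map on $\widehat{V}$. -}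

module Defs where

open import Level using (Level; suc; _⊔_; 0ℓ)
open import Algebra.Bundles using (CommutativeRing; Group; Semiring)
open import Algebra.Module.Bundles using (Module)
open import Algebra.Module.Bundles.Raw using (RawModule)
open import Algebra.Module.Morphism.Structures using (IsModuleHomomorphism; IsModuleMonomorphism)
open import Algebra.Morphism.Structures using (IsRingHomomorphism)
open import Data.Integer.Base using (ℤ; +_; ∣_∣)
open import Data.List.Base using (List; []; _∷_; foldr; map)
open import Data.List.Relation.Unary.All using (All)
open import Data.Nat.Base using (ℕ; NonZero) renaming (_≤_ to _≤ℕ_)
open import Data.Nat.Divisibility using (_∤_)
open import Data.Product using (∃; ∃-syntax; ∃!; Σ-syntax; _×_; _,_; proj₁; proj₂)
open import Data.Rational.Base using (ℚ; _/_; 1/_; ≢-nonZero)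
import Data.Rational.Properties as ℚ
open import Function.Definitions using (Congruent)
open import Relation.Binary.Bundles using (TotalOrder)
open import Relation.Binary.Core using (Rel)
open import Relation.Binary.Structures using (IsTotalOrder)
open import Relation.Nullary using (¬_)
open import Relation.Unary using (Pred; Satisfiable)
import Algebra.Construct.NaturalChoice.Max as Max
import Algebra.Module.Morphism.ModuleMonomorphism as ModuleMonomorphism
import Algebra.Definitions.RawSemiring as RawSemiringOps
import Data.List.Membership.Setoid as Membership
import Data.List.Relation.Binary.Subset.Setoid as Subset
import Data.List.Relation.Unary.Unique.Setoid as UniqueIn
import Relation.Binary.Construct.NonStrictToStrict as ToStrict

TFAE₃ : ∀ {a b c} → Set a → Set b → Set c → Set (a ⊔ b ⊔ c)
TFAE₃ P Q R = (P → Q) × (Q → R) × (R → P)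

record IsField {c ℓ} (R : CommutativeRing c ℓ) : Set (c ⊔ ℓ) where
  open CommutativeRing R
  field
    1≉0     : ¬ 1# ≈ 0#
    inverse : ∀ x → ¬ x ≈ 0# → ∃[ y ] x * y ≈ 1#

module Bounds {ℓ : Level} {A : Set ℓ} (_≤_ : Rel A ℓ) where
  IsUpperBound IsLowerBound IsSup IsInf : Pred A ℓ → A → Set ℓ
  IsUpperBound S b = ∀ x → S x → x ≤ b
  IsLowerBound S b = ∀ x → S x → b ≤ x
  IsSup S s = IsUpperBound S s × (∀ b → IsUpperBound S b → s ≤ b)
  IsInf S s = IsLowerBound S s × (∀ b → IsLowerBound S b → b ≤ s)

-- The real numbers, which the library does not provide, are characterised
-- (up to unique isomorphism) as a Dedekind-complete ordered field.
record RealNumbers (ℓ : Level) : Set (suc ℓ) where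
  infix 4 _≤_
  field
    commutativeRing : CommutativeRing ℓ ℓ
    isField         : IsField commutativeRing
  open CommutativeRing commutativeRing public
  field
    _≤_          : Rel Carrier ℓ
    isTotalOrder : IsTotalOrder _≈_ _≤_
    +-monoˡ-≤    : ∀ {x y} z → x ≤ y → x + z ≤ y + z
    *-nonneg     : ∀ {x y} → 0# ≤ x → 0# ≤ y → 0# ≤ x * y
  open Bounds _≤_ public
  field
    sup : ∀ (S : Pred Carrier ℓ) → Satisfiable S → ∃ (IsUpperBound S) → ∃ (IsSup S)

  totalOrder : TotalOrder ℓ ℓ ℓ
  totalOrder = record { isTotalOrder = isTotalOrder }

  open ToStrict _≈_ _≤_ public using (_<_)
  open Max totalOrder public using () renaming (_⊔_ to max)

module _ {ℓ : Level} (ℝ : RealNumbers ℓ) where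
  private module ℝ = RealNumbers ℝ

  module Metric {a : Level} {A : Set a} (d : A → A → ℝ.Carrier) where

    IsCauchy : (ℕ → A) → Set ℓ
    IsCauchy x = ∀ ε → ℝ.0# ℝ.< ε →
      ∃[ N ] (∀ m n → N ≤ℕ m → N ≤ℕ n → d (x m) (x n) ℝ.< ε)

    _ConvergesTo_ : (ℕ → A) → A → Set ℓ
    x ConvergesTo l = ∀ ε → ℝ.0# ℝ.< ε → ∃[ N ] (∀ n → N ≤ℕ n → d (x n) l ℝ.< ε)

    IsComplete : Set (a ⊔ ℓ)
    IsComplete = ∀ x → IsCauchy x → ∃[ l ] x ConvergesTo l

    HasDenseImage : {b : Level} {B : Set b} → (B → A) → Set (a ⊔ b ⊔ ℓ)
    HasDenseImage f = ∀ y ε → ℝ.0# ℝ.< ε → ∃[ x ] d (f x) y ℝ.< ε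

  record AbsoluteValue {c : Level} (R : CommutativeRing c c) : Set (c ⊔ ℓ) where
    open CommutativeRing R
    field
      abs             : Carrier → ℝ.Carrier
      abs-cong        : Congruent _≈_ ℝ._≈_ abs
      abs-nonneg      : ∀ x → ℝ.0# ℝ.≤ abs x
      abs-0           : abs 0# ℝ.≈ ℝ.0#
      abs-definite    : ∀ x → abs x ℝ.≈ ℝ.0# → x ≈ 0#
      abs-*           : ∀ x y → abs (x * y) ℝ.≈ abs x ℝ.* abs y
      abs-ultrametric : ∀ x y → abs (x + y) ℝ.≤ ℝ.max (abs x) (abs y)

  record ValuedField (c : Level) : Set (suc c ⊔ ℓ) where
    field
      commutativeRing : CommutativeRing c c
      isField         : IsField commutativeRing
      absoluteValue   : AbsoluteValue commutativeRing
    open CommutativeRing commutativeRing public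
    open AbsoluteValue absoluteValue public

    dist : Carrier → Carrier → ℝ.Carrier
    dist x y = abs (x - y)

module _ {ℓ : Level} {ℝ : RealNumbers ℓ} where
  private
    module ℝ = RealNumbers ℝ
    module ℝ-ops = RawSemiringOps (Semiring.rawSemiring ℝ.semiring)

  -- By multiplicativity these two conditions say |pᵏ·(a/b)| = p⁻ᵏ for a, b prime to p.
  record IsPAdic (p : ℕ) (v : AbsoluteValue ℝ ℚ.+-*-commutativeRing) : Set ℓ where
    open AbsoluteValue v
    field
      abs-p    : abs (+ p / 1) ℝ.* (p ℝ-ops.× ℝ.1#) ℝ.≈ ℝ.1#
      abs-unit : ∀ (a : ℤ) (b : ℕ) .{{_ : NonZero b}} →
                 p ∤ ∣ a ∣ → p ∤ b → abs (a / b) ℝ.≈ ℝ.1#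

  ℚ-isField : IsField ℚ.+-*-commutativeRing
  ℚ-isField = record
    { 1≉0     = λ ()
    ; inverse = λ x x≢0 → let instance _ = ≢-nonZero x≢0 in 1/ x , ℚ.*-inverseʳ x
    }

  ℚ-valued : AbsoluteValue ℝ ℚ.+-*-commutativeRing → ValuedField ℝ 0ℓ
  ℚ-valued v = record { isField = ℚ-isField ; absoluteValue = v }

  module _ {c d : Level} (K : ValuedField ℝ c) (L : ValuedField ℝ d) where
    private
      module K = ValuedField K
      module L = ValuedField L

    record IsIsometricExtension (ι : K.Carrier → L.Carrier) : Set (c ⊔ d ⊔ ℓ) where
      field
        isRingHomomorphism : IsRingHomomorphism K.rawRing L.rawRing ι
        isometric          : ∀ x → L.abs (ι x) ℝ.≈ K.abs x

    record IsFieldCompletion (ι : K.Carrier → L.Carrier) : Set (c ⊔ d ⊔ ℓ) where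
      field
        isIsometricExtension : IsIsometricExtension ι
        complete             : Metric.IsComplete ℝ L.dist
        dense                : Metric.HasDenseImage ℝ L.dist ι

  -- The monic polynomial Xⁿ + cₙ₋₁Xⁿ⁻¹ + … + c₀ is encoded by [c₀, …, cₙ₋₁].
  evalMonic : {c : Level} (R : CommutativeRing c c) →
              List (CommutativeRing.Carrier R) → CommutativeRing.Carrier R → CommutativeRing.Carrier R
  evalMonic R cs x = foldr (λ c r → c + x * r) 1# cs
    where open CommutativeRing R

  IsAlgebraicallyClosed : {c : Level} → ValuedField ℝ c → Set c
  IsAlgebraicallyClosed K = ∀ c cs → ∃[ x ] evalMonic commutativeRing (c ∷ cs) x ≈ 0#
    where open ValuedField K

  module _ {c d : Level} (K : ValuedField ℝ c) (L : ValuedField ℝ d) where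
    private
      module K = ValuedField K
      module L = ValuedField L

    record IsAlgebraicClosure (ι : K.Carrier → L.Carrier) : Set (c ⊔ d ⊔ ℓ) where
      field
        isIsometricExtension : IsIsometricExtension K L ι
        algebraic            : ∀ y → ∃[ cs ] evalMonic L.commutativeRing (map ι cs) y L.≈ L.0#
        algebraicallyClosed  : IsAlgebraicallyClosed L

-- ℂₚ together with the tower ℚ → ℚₚ → ℚ̄ₚ → ℂₚ exhibiting it as the completion
-- of an algebraic closure of the p-adic completion of ℚ.
record ComplexPAdicNumbers {ℓ} (ℝ : RealNumbers ℓ) (p : ℕ) : Set (suc ℓ) where
  field
    ∣∣ₚ   : AbsoluteValue ℝ ℚ.+-*-commutativeRing
    pAdic : IsPAdic p ∣∣ₚ
    ℚₚ ℚ̄ₚ ℂₚ : ValuedField ℝ ℓ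

    ℚ→ℚₚ              : ℚ → ValuedField.Carrier ℚₚ
    ℚₚ-completion     : IsFieldCompletion (ℚ-valued ∣∣ₚ) ℚₚ ℚ→ℚₚ
    ℚₚ→ℚ̄ₚ             : ValuedField.Carrier ℚₚ → ValuedField.Carrier ℚ̄ₚ
    ℚ̄ₚ-closure        : IsAlgebraicClosure ℚₚ ℚ̄ₚ ℚₚ→ℚ̄ₚ
    ℚ̄ₚ→ℂₚ             : ValuedField.Carrier ℚ̄ₚ → ValuedField.Carrier ℂₚ
    ℂₚ-completion     : IsFieldCompletion ℚ̄ₚ ℂₚ ℚ̄ₚ→ℂₚ

VectorSpace : ∀ {ℓ} {ℝ : RealNumbers ℓ} → ValuedField ℝ ℓ → Set (suc ℓ)
VectorSpace {ℓ} K = Module (ValuedField.commutativeRing K) ℓ ℓ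

module _ {ℓ : Level} {ℝ : RealNumbers ℓ} {K : ValuedField ℝ ℓ} where
  private
    module ℝ = RealNumbers ℝ
    module K = ValuedField K

  record Norm (W : VectorSpace K) : Set ℓ where
    open Module W
    field
      ‖_‖           : Carrierᴹ → ℝ.Carrier
      ‖‖-cong       : Congruent _≈ᴹ_ ℝ._≈_ ‖_‖
      nonneg        : ∀ x → ℝ.0# ℝ.≤ ‖ x ‖
      definite      : ∀ x → ‖ x ‖ ℝ.≈ ℝ.0# → x ≈ᴹ 0ᴹ
      homogeneous   : ∀ a x → ‖ a *ₗ x ‖ ℝ.≈ K.abs a ℝ.* ‖ x ‖
      ultrametric   : ∀ x y → ‖ x +ᴹ y ‖ ℝ.≤ ℝ.max ‖ x ‖ ‖ y ‖

    dist : Carrierᴹ → Carrierᴹ → ℝ.Carrier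
    dist x y = ‖ x +ᴹ (-ᴹ y) ‖

    IsComplete : Set ℓ
    IsComplete = Metric.IsComplete ℝ dist

  IsLinear : (W X : VectorSpace K) → (Module.Carrierᴹ W → Module.Carrierᴹ X) → Set ℓ
  IsLinear W X = IsModuleHomomorphism (Module.rawModule W) (Module.rawModule X)

  module _ {W : VectorSpace K} where
    open Module W

    _≗ᴺ_ _≤ᴺ_ IsDominatedBy AreEquivalent : Norm W → Norm W → Set ℓ
    N ≗ᴺ N′ = ∀ x → Norm.‖_‖ N x ℝ.≈ Norm.‖_‖ N′ x
    N ≤ᴺ N′ = ∀ x → Norm.‖_‖ N x ℝ.≤ Norm.‖_‖ N′ x
    IsDominatedBy N N′ = ∃[ D ] (ℝ.0# ℝ.< D × (∀ x → Norm.‖_‖ N x ℝ.≤ D ℝ.* Norm.‖_‖ N′ x))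
    AreEquivalent N N′ = IsDominatedBy N N′ × IsDominatedBy N′ N

    IsNormalizedAt : Carrierᴹ → Norm W → Set ℓ
    IsNormalizedAt w N = Norm.‖_‖ N w ℝ.≈ ℝ.1#

    IsQuotientNorm : Norm W → Pred Carrierᴹ ℓ → Carrierᴹ → ℝ.Carrier → Set ℓ
    IsQuotientNorm N S x r = ℝ.IsInf (λ t → ∃[ k ] (S k × t ℝ.≈ Norm.‖_‖ N (x +ᴹ k))) r

  module _ {W X : VectorSpace K} (NW : Norm W) (NX : Norm X) where
    private
      module W = Module W
      module X = Module X
      module NW = Norm NW
      module NX = Norm NX

    IsContinuous : (W.Carrierᴹ → X.Carrierᴹ) → Set ℓ
    IsContinuous f = ∀ x ε → ℝ.0# ℝ.< ε → ∃[ δ ] (ℝ.0# ℝ.< δ ×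
      (∀ y → NW.dist x y ℝ.< δ → NX.dist (f x) (f y) ℝ.< ε))

    Kernel : (W.Carrierᴹ → X.Carrierᴹ) → Pred W.Carrierᴹ ℓ
    Kernel f x = f x X.≈ᴹ X.0ᴹ

    -- The map W/ker f → X sends the class of x to f x.
    InducesIsometryFromQuotient : (W.Carrierᴹ → X.Carrierᴹ) → Set ℓ
    InducesIsometryFromQuotient f = ∀ x → IsQuotientNorm NW (Kernel f) x (NX.‖ f x ‖)

  record Completion {W : VectorSpace K} (N : Norm W) : Set (suc ℓ) where
    field
      space : VectorSpace K
      norm  : Norm space
    open Module space public
    open Norm norm public
    field
      complete  : IsComplete
      ι         : Module.Carrierᴹ W → Carrierᴹ
      linear    : IsLinear W space ι
      isometric : ∀ w → ‖ ι w ‖ ℝ.≈ Norm.‖_‖ N w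
      dense     : Metric.HasDenseImage ℝ dist ι

  record Representation (G : Group ℓ ℓ) (W : VectorSpace K) : Set ℓ where
    open Module W
    private module G = Group G
    infixr 8 _·_
    field
      _·_        : G.Carrier → Carrierᴹ → Carrierᴹ
      ·-cong     : ∀ {g h x y} → g G.≈ h → x ≈ᴹ y → g · x ≈ᴹ h · y
      ·-linear   : ∀ g → IsLinear W W (g ·_)
      ·-identity : ∀ x → G.ε · x ≈ᴹ x
      ·-assoc    : ∀ g h x → (g G.∙ h) · x ≈ᴹ g · (h · x)

  record BanachRepresentation (G : Group ℓ ℓ) : Set (suc ℓ) where
    field
      space          : VectorSpace K
      representation : Representation G space
      norm           : Norm space
    open Module space public
    open Representation representation public
    open Norm norm public
    field
      invariant : ∀ g x → ‖ g · x ‖ ℝ.≈ ‖ x ‖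
      complete  : IsComplete

  module _ {G : Group ℓ ℓ} {W : VectorSpace K} (ρ : Representation G W) where
    private
      module G = Group G
      module W = Module W
    open W using (Carrierᴹ; _≈ᴹ_; _+ᴹ_; -ᴹ_; 0ᴹ; _*ₗ_)
    open Representation ρ
    open Membership G.setoid using (_∈_)
    open Subset G.setoid using (_⊆_)
    open UniqueIn G.setoid using (Unique)

    IsInvariant : Norm W → Set ℓ
    IsInvariant N = ∀ g x → Norm.‖_‖ N (g · x) ℝ.≈ Norm.‖_‖ N x

    IsLocallyMaximalAt : Carrierᴹ → Norm W → Set ℓ
    IsLocallyMaximalAt w N = ∀ (N′ : Norm W) → IsInvariant N′ → IsNormalizedAt w N′ →
      IsDominatedBy N′ N → N′ ≤ᴺ N

    IsSummable : (G.Carrier → K.Carrier) → Set ℓ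
    IsSummable c = ∀ ε → ℝ.0# ℝ.< ε → ∃[ gs ] (∀ g → ε ℝ.≤ K.abs (c g) → g ∈ gs)

    -- Convergence along the directed set of finite subsets of G; these are
    -- represented by duplicate-free lists.
    HasSum : Norm W → (G.Carrier → Carrierᴹ) → Carrierᴹ → Set ℓ
    HasSum N f w = ∀ ε → ℝ.0# ℝ.< ε → ∃[ gs₀ ] (∀ gs → Unique gs → gs₀ ⊆ gs →
      Norm.dist N (foldr (λ g s → f g +ᴹ s) 0ᴹ gs) w ℝ.< ε)

    IsStronglyCyclic : Norm W → Carrierᴹ → Set ℓ
    IsStronglyCyclic N v = (¬ v ≈ᴹ 0ᴹ) × (∀ w → ∃[ c ]
      (Congruent G._≈_ K._≈_ c × IsSummable c × HasSum N (λ g → c g *ₗ (g · v)) w))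

    -- The defining properties of the norm ‖·‖_{v,B}, where N is the norm of B.
    IsCanonicalNorm : Norm W → Carrierᴹ → Norm W → Set ℓ
    IsCanonicalNorm N v N′ = IsInvariant N′ × AreEquivalent N′ N ×
      IsNormalizedAt v N′ × IsLocallyMaximalAt v N′

    -- N = ‖·‖_{v,B}: the norm ‖·‖_{v,B} is the unique one with its defining
    -- properties, and N coincides with it.
    EqualsCanonicalNorm : Norm W → Carrierᴹ → Set ℓ
    EqualsCanonicalNorm N v = Σ[ (N′ , _) ∈ ∃! _≗ᴺ_ (IsCanonicalNorm N v) ] N ≗ᴺ N′

    data Generated (v : Carrierᴹ) : Pred Carrierᴹ ℓ where
      generator : Generated v v
      zero      : Generated v 0ᴹ
      add       : ∀ {x y} → Generated v x → Generated v y → Generated v (x +ᴹ y)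
      scale     : ∀ a {x} → Generated v x → Generated v (a *ₗ x)
      act       : ∀ g {x} → Generated v x → Generated v (g · x)
      respects  : ∀ {x y} → x ≈ᴹ y → Generated v x → Generated v y

    module _ (v : Carrierᴹ) where
      private
        -1*x≈-x : ∀ x → (K.- K.1#) *ₗ x ≈ᴹ -ᴹ x
        -1*x≈-x x = W.uniqueˡ‿-ᴹ _ x (begin
          (K.- K.1#) *ₗ x +ᴹ x           ≈⟨ W.+ᴹ-congˡ (W.*ₗ-identityˡ x) ⟨
          (K.- K.1#) *ₗ x +ᴹ K.1# *ₗ x   ≈⟨ W.*ₗ-distribʳ x (K.- K.1#) K.1# ⟨
          (K.- K.1# K.+ K.1#) *ₗ x       ≈⟨ W.*ₗ-congʳ (K.-‿inverseˡ K.1#) ⟩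
          K.0# *ₗ x                      ≈⟨ W.*ₗ-zeroˡ x ⟩
          0ᴹ                             ∎)
          where open import Relation.Binary.Reasoning.Setoid W.≈ᴹ-setoid

        rawModule : RawModule K.Carrier ℓ ℓ
        rawModule = record
          { Carrierᴹ = ∃ (Generated v)
          ; _≈ᴹ_     = λ (x , _) (y , _) → x ≈ᴹ y
          ; _+ᴹ_     = λ (x , p) (y , q) → x +ᴹ y , add p q
          ; _*ₗ_     = λ a (x , p) → a *ₗ x , scale a p
          ; _*ᵣ_     = λ (x , p) a → a *ₗ x , scale a p
          ; 0ᴹ       = 0ᴹ , zero
          ; -ᴹ_      = λ (x , p) → -ᴹ x , respects (-1*x≈-x x) (scale (K.- K.1#) p)
          }

        inclusion-mono : IsModuleMonomorphism rawModule W.rawModule proj₁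
        inclusion-mono = record
          { isModuleHomomorphism = record
            { isBimoduleHomomorphism = record
              { +ᴹ-isGroupHomomorphism = record
                { isMonoidHomomorphism = record
                  { isMagmaHomomorphism = record
                    { isRelHomomorphism = record { cong = λ x≈y → x≈y }
                    ; homo = λ _ _ → W.≈ᴹ-refl
                    }
                  ; ε-homo = W.≈ᴹ-refl
                  }
                ; ⁻¹-homo = λ _ → W.≈ᴹ-refl
                }
              ; *ₗ-homo = λ _ _ → W.≈ᴹ-refl
              ; *ᵣ-homo = λ a (x , _) → W.*ₗ-*ᵣ-coincident a x
              }
            }
          ; injective = λ x≈y → x≈y
          }

      -- The sub-representation generated by v, as a vector space.
      generatedSubspace : VectorSpace K
      generatedSubspace = record
        { RawModule rawModule
        ; isModule = ModuleMonomorphism.isModule inclusion-mono K.isCommutativeRing W.isModule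
        }

      private module V = Module generatedSubspace

      -- L_v = 𝒪[G]·v, an element of the group ring 𝒪[G] being a formal finite
      -- sum of terms (λ , g).
      Lattice : Pred Carrierᴹ ℓ
      Lattice w = Σ[ xs ∈ List (K.Carrier × G.Carrier) ] (All (λ (a , _) → K.abs a ℝ.≤ ℝ.1#) xs ×
        w ≈ᴹ foldr (λ (a , g) s → (a *ₗ (g · v)) +ᴹ s) 0ᴹ xs)

      IsGaugeNorm : Norm generatedSubspace → Set ℓ
      IsGaugeNorm N = ∀ ((w , p) : V.Carrierᴹ) →
        ℝ.IsInf (λ r → ∃[ a ] (r ℝ.≈ K.abs a × ∃[ l ] (Lattice l × w ≈ᴹ a *ₗ l)))
                (Norm.‖_‖ N (w , p))

      record UniversalUnitaryCompletion : Set (suc ℓ) where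
        field
          gaugeNorm   : Norm generatedSubspace
          isGaugeNorm : IsGaugeNorm gaugeNorm
          completion  : Completion gaugeNorm
        open Completion completion public

      record ExtensionOfInclusion (N : Norm W) (V̂ : UniversalUnitaryCompletion) : Set ℓ where
        private module V̂ = UniversalUnitaryCompletion V̂
        field
          I          : V̂.Carrierᴹ → Carrierᴹ
          linear     : IsLinear V̂.space W I
          continuous : IsContinuous V̂.norm N I
          extends    : ∀ w → I (V̂.ι w) ≈ᴹ proj₁ w

{-# OPTIONS --safe #-}
module Submission where

-- The key consequence of local maximality is an approximation property: every w
-- with ‖w‖ < r is within r/2 of a finite sum Σ λ_g g(v) with all |λ_g| ≤ r.  It
-- follows by comparing ‖·‖ with the norm
--   w ↦ inf { t : ∃ l = Σ λ_g g(v), |λ_g| ≤ t and 2‖w − l‖ ≤ t },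
-- which is invariant, normalized at v and bounded by 2‖·‖.  Iterating the
-- approximation writes w as a convergent series: the coefficients converge in
-- the field, so v is strongly cyclic, and the partial sums converge in V̂ to a
-- preimage of w of norm at most r, so the quotient map is an isometry.  This
-- avoids both the open mapping theorem and density of the value group.
-- Conversely, if V̂/K → B is an isometry, then approximating a preimage of w by
-- elements of V bounds every dominated invariant normalized norm by the
-- quotient norm.

open import Level using (Level)
open import Algebra.Bundles using (CommutativeMonoid; Group)
open import Algebra.Module.Bundles using (Module)
open import Algebra.Module.Morphism.Structures using (IsModuleHomomorphism)
open import Algebra.Module.Structures.Biased using (IsModuleFromLeft)
open import Axiom.ExcludedMiddle using (ExcludedMiddle)
open import Data.List.Base using (List; []; _∷_; _++_; map; foldr)
open import Data.List.Relation.Unary.All as All using (All; []; _∷_)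
open import Data.List.Relation.Unary.AllPairs.Core using (_∷_)
open import Data.List.Relation.Unary.Any using (here; there)
open import Data.Nat.Base using (ℕ; _≤′_; ≤′-refl; ≤′-step) renaming (zero to 0ℕ; suc to 1+_; _≤_ to _≤ℕ_; _⊔_ to _⊔ℕ_)
open import Data.Nat.Primality using (Prime)
open import Data.Product using (_×_; _,_; ∃; ∃-syntax; proj₁; proj₂)
open import Data.Sum.Base using (_⊎_; inj₁; inj₂)
open import Function.Base using (_∘_; flip)
open import Function.Definitions using (Congruent; Surjective)
open import Relation.Binary.Bundles using (TotalOrder)
open import Relation.Nullary using (¬_; Dec; yes; no; contradiction)
open import Relation.Nullary.Decidable using (decidable-stable)
open import Relation.Unary using (Pred; Satisfiable)
import Algebra.Construct.NaturalChoice.Max as Max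
import Algebra.Module.Construct.TensorUnit as TensorUnit
import Algebra.Module.Properties as ModuleProperties
import Algebra.Properties.AbelianGroup as AbelianGroupProperties
import Algebra.Properties.CommutativeSemigroup as CommutativeSemigroupProperties
import Algebra.Properties.Ring as RingProperties
import Data.List.Membership.Setoid as Membership
import Data.List.Membership.Setoid.Properties as Membershipₚ
import Data.List.Relation.Binary.Subset.Setoid as Subset
import Data.List.Relation.Unary.All.Properties as All
import Data.List.Relation.Unary.Unique.Setoid as UniqueIn
import Data.Nat.Properties as ℕ
import Relation.Binary.Properties.TotalOrder as TotalOrderProperties
import Relation.Binary.Reasoning.PartialOrder as PartialOrderReasoning
import Relation.Binary.Reasoning.Setoid as SetoidReasoning
open import Defs

-- Three points shape the argument. (a) Statement (2) speaks about every model of V̂ and of I, so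
-- nothing follows from it until one model exists; hence the completion by Cauchy sequences and the
-- extension of bounded maps to it. (b) Statement (2) does not mention ‖v‖, so ‖v‖ = 1 has to be
-- extracted from the isometry, and the comparison of an invariant norm with the gauge must carry
-- the factor ‖v‖ until then. (c) The gauge of the lattice is an infimum over absolute values of
-- scalars, while the approximations are governed by real bounds on coefficients. A finite
-- combination has a largest coefficient, so both infima agree. The isometry in (2) demands sharp
-- constants. They survive because every error enters through a maximum: a telescoping sum of steps
-- of sizes r, r/2, r/4, ... has size at most r, and an error scaled by a fixed constant vanishes in
-- the limit without enlarging the main term.

-- Order, infima and the sequence r/2ⁿ in the real numbers

module RealProperties {ℓ : Level} (em : ExcludedMiddle ℓ) (ℝ : RealNumbers ℓ) where
  open RealNumbers ℝ public
  open TotalOrder totalOrder public using (poset; antisym; total)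
    renaming (refl to ≤-refl; trans to ≤-trans; reflexive to ≤-reflexive)
  open TotalOrderProperties totalOrder public using (≰⇒>; <⇒≱; <-trans)
  open Max totalOrder public using (⊔-sel; x≤x⊔y; x≤y⊔x; ⊔-lub; ⊔-mono-≤)
  open RingProperties ring
  module ≤-Reasoning = PartialOrderReasoning poset
  open ≤-Reasoning

  ≮⇒≥ : ∀ {x y} → ¬ x < y → y ≤ x
  ≮⇒≥ x≮y = decidable-stable em λ y≰x → x≮y (≰⇒> y≰x)

  ≤-<-trans : ∀ {x y z} → x ≤ y → y < z → x < z
  ≤-<-trans {x} {y} {z} x≤y y<z = begin-strict x ≤⟨ x≤y ⟩ y <⟨ y<z ⟩ z ∎

  <-≤-trans : ∀ {x y z} → x < y → y ≤ z → x < z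
  <-≤-trans {x} {y} {z} x<y y≤z = begin-strict x <⟨ x<y ⟩ y ≤⟨ y≤z ⟩ z ∎

  x≤0⇒0≤-x : ∀ {x} → x ≤ 0# → 0# ≤ - x
  x≤0⇒0≤-x {x} x≤0 = begin
    0#      ≈⟨ -‿inverseʳ x ⟨
    x - x   ≤⟨ +-monoˡ-≤ (- x) x≤0 ⟩
    0# - x  ≈⟨ +-identityˡ (- x) ⟩
    - x     ∎

  +-cancelʳ-≤ : ∀ {x y} z → x + z ≤ y + z → x ≤ y
  +-cancelʳ-≤ {x} {y} z x+z≤y+z = begin
    x          ≈⟨ x+z-z x ⟨
    x + z - z  ≤⟨ +-monoˡ-≤ (- z) x+z≤y+z ⟩
    y + z - z  ≈⟨ x+z-z y ⟩
    y          ∎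
    where
    x+z-z : ∀ x → x + z - z ≈ x
    x+z-z x = trans (+-assoc x z (- z)) (trans (+-congˡ (-‿inverseʳ z)) (+-identityʳ x))

  +-monoˡ-< : ∀ {x y} z → x < y → x + z < y + z
  +-monoˡ-< z x<y = ≰⇒> (<⇒≱ x<y ∘ +-cancelʳ-≤ z)

  +-monoʳ-< : ∀ {x y} z → x < y → z + x < z + y
  +-monoʳ-< {x} {y} z x<y = begin-strict
    z + x  ≈⟨ +-comm z x ⟩
    x + z  <⟨ +-monoˡ-< z x<y ⟩
    y + z  ≈⟨ +-comm y z ⟩
    z + y  ∎

  *-monoʳ-≤ : ∀ {x y z} → 0# ≤ z → x ≤ y → z * x ≤ z * y
  *-monoʳ-≤ {x} {y} {z} 0≤z x≤y = begin
    z * x                    ≈⟨ +-identityˡ (z * x) ⟨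
    0# + z * x               ≤⟨ +-monoˡ-≤ (z * x) (*-nonneg 0≤z 0≤y-x) ⟩
    z * (y - x) + z * x      ≈⟨ distribˡ z (y - x) x ⟨
    z * (y - x + x)          ≈⟨ *-congˡ (+-assoc y (- x) x) ⟩
    z * (y + (- x + x))      ≈⟨ *-congˡ (+-congˡ (-‿inverseˡ x)) ⟩
    z * (y + 0#)             ≈⟨ *-congˡ (+-identityʳ y) ⟩
    z * y                    ∎
    where
    0≤y-x : 0# ≤ y - x
    0≤y-x = begin
      0#     ≈⟨ -‿inverseʳ x ⟨
      x - x  ≤⟨ +-monoˡ-≤ (- x) x≤y ⟩
      y - x  ∎

  0≤1 : 0# ≤ 1#
  0≤1 with total 0# 1#
  ... | inj₁ 0≤1 = 0≤1
  ... | inj₂ 1≤0 = begin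
    0#           ≤⟨ *-nonneg (x≤0⇒0≤-x 1≤0) (x≤0⇒0≤-x 1≤0) ⟩
    - 1# * - 1#  ≈⟨ -1*x≈-x (- 1#) ⟩
    - - 1#       ≈⟨ -‿involutive 1# ⟩
    1#           ∎

  0<1 : 0# < 1#
  0<1 = 0≤1 , IsField.1≉0 isField ∘ sym

  positive-inverse : ∀ {x} → 0# < x → ∃[ y ] (0# < y × x * y ≈ 1#)
  positive-inverse {x} 0<x@(0≤x , 0≉x) with IsField.inverse isField x (0≉x ∘ sym)
  ... | y , xy≈1 = y , ≰⇒> y≰0 , xy≈1
    where
    y≰0 : ¬ y ≤ 0#
    y≰0 y≤0 = <⇒≱ 0<1 (begin
      1#      ≈⟨ xy≈1 ⟨
      x * y   ≤⟨ *-monoʳ-≤ 0≤x y≤0 ⟩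
      x * 0#  ≈⟨ zeroʳ x ⟩
      0#      ∎)

  *-cancelˡ-≤ : ∀ {x y z} → 0# < z → z * x ≤ z * y → x ≤ y
  *-cancelˡ-≤ {x} {y} {z} 0<z zx≤zy with positive-inverse 0<z
  ... | w , 0<w , zw≈1 = begin
    x            ≈⟨ w*z*x x ⟨
    w * (z * x)  ≤⟨ *-monoʳ-≤ (proj₁ 0<w) zx≤zy ⟩
    w * (z * y)  ≈⟨ w*z*x y ⟩
    y            ∎
    where
    w*z*x : ∀ x → w * (z * x) ≈ x
    w*z*x x = trans (sym (*-assoc w z x)) (trans (*-congʳ (trans (*-comm w z) zw≈1)) (*-identityˡ x))

  *-monoʳ-< : ∀ {x y z} → 0# < z → x < y → z * x < z * y
  *-monoʳ-< 0<z x<y = ≰⇒> (<⇒≱ x<y ∘ *-cancelˡ-≤ 0<z)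

  *-positive : ∀ {x y} → 0# < x → 0# < y → 0# < x * y
  *-positive {x} {y} 0<x 0<y = begin-strict
    0#      ≈⟨ zeroʳ x ⟨
    x * 0#  <⟨ *-monoʳ-< 0<x 0<y ⟩
    x * y   ∎

  2# : Carrier
  2# = 1# + 1#

  1<2 : 1# < 2#
  1<2 = begin-strict
    1#       ≈⟨ +-identityˡ 1# ⟨
    0# + 1#  <⟨ +-monoˡ-< 1# 0<1 ⟩
    2#       ∎

  0<2 : 0# < 2#
  0<2 = <-trans 0<1 1<2

  2*x≈x+x : ∀ x → 2# * x ≈ x + x
  2*x≈x+x x = trans (distribʳ x 1# 1#) (+-cong (*-identityˡ x) (*-identityˡ x))

  ½ : Carrier
  ½ = proj₁ (positive-inverse 0<2)

  0<½ : 0# < ½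
  0<½ = proj₁ (proj₂ (positive-inverse 0<2))

  2*½*x≈x : ∀ x → 2# * (½ * x) ≈ x
  2*½*x≈x x = trans (sym (*-assoc 2# ½ x))
    (trans (*-congʳ (proj₂ (proj₂ (positive-inverse 0<2)))) (*-identityˡ x))

  ½*[x+x]≈x : ∀ x → ½ * (x + x) ≈ x
  ½*[x+x]≈x x = begin-equality
    ½ * (x + x)    ≈⟨ *-congˡ (2*x≈x+x x) ⟨
    ½ * (2# * x)   ≈⟨ *-assoc ½ 2# x ⟨
    ½ * 2# * x     ≈⟨ *-congʳ (*-comm ½ 2#) ⟩
    2# * ½ * x     ≈⟨ *-assoc 2# ½ x ⟩
    2# * (½ * x)   ≈⟨ 2*½*x≈x x ⟩
    x              ∎

  x≤2x : ∀ {x} → 0# ≤ x → x ≤ 2# * x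
  x≤2x {x} 0≤x = begin
    x        ≈⟨ +-identityˡ x ⟨
    0# + x   ≤⟨ +-monoˡ-≤ x 0≤x ⟩
    x + x    ≈⟨ 2*x≈x+x x ⟨
    2# * x   ∎

  ½*x<x : ∀ {x} → 0# < x → ½ * x < x
  ½*x<x {x} 0<x = begin-strict
    ½ * x             ≈⟨ +-identityˡ (½ * x) ⟨
    0# + ½ * x        <⟨ +-monoˡ-< (½ * x) (*-positive 0<½ 0<x) ⟩
    ½ * x + ½ * x     ≈⟨ distribˡ ½ x x ⟨
    ½ * (x + x)       ≈⟨ ½*[x+x]≈x x ⟩
    x                 ∎

  between : ∀ {x y} → x < y → ∃[ z ] (x < z × z < y)
  between {x} {y} x<y = ½ * (x + y)
    , (begin-strict
        x            ≈⟨ ½*[x+x]≈x x ⟨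
        ½ * (x + x)  <⟨ *-monoʳ-< 0<½ (+-monoʳ-< x x<y) ⟩
        ½ * (x + y)  ∎)
    , (begin-strict
        ½ * (x + y)  <⟨ *-monoʳ-< 0<½ (+-monoˡ-< y x<y) ⟩
        ½ * (y + y)  ≈⟨ ½*[x+x]≈x y ⟩
        y            ∎)

  max-<-lub : ∀ {x y z} → x < z → y < z → max x y < z
  max-<-lub {x} {y} {z} x<z y<z with ⊔-sel x y
  ... | inj₁ eq = begin-strict max x y ≈⟨ eq ⟩ x <⟨ x<z ⟩ z ∎
  ... | inj₂ eq = begin-strict max x y ≈⟨ eq ⟩ y <⟨ y<z ⟩ z ∎

  *-max-≤ : ∀ {x y z w} → x * y ≤ w → x * z ≤ w → x * max y z ≤ w
  *-max-≤ {x} {y} {z} {w} xy≤w xz≤w with ⊔-sel y z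
  ... | inj₁ eq = begin x * max y z ≈⟨ *-congˡ eq ⟩ x * y ≤⟨ xy≤w ⟩ w ∎
  ... | inj₂ eq = begin x * max y z ≈⟨ *-congˡ eq ⟩ x * z ≤⟨ xz≤w ⟩ w ∎

  -- A bound of the form `max y ε` is what the ultrametric inequality gives when a vector is
  -- replaced by one at distance at most ε. If y < x, then x is positive and ε = x/2 contradicts the
  -- bound.
  ≤max-small⇒≤ : ∀ {x y} → 0# ≤ y → (∀ ε → 0# < ε → x ≤ max y ε) → x ≤ y
  ≤max-small⇒≤ {x} {y} 0≤y bound = ≮⇒≥ λ y<x →
    let 0<x = ≤-<-trans 0≤y y<x in
    <⇒≱ (max-<-lub y<x (½*x<x 0<x)) (bound (½ * x) (*-positive 0<½ 0<x))

  ≤-small⇒≤0 : ∀ {x} → (∀ ε → 0# < ε → x ≤ ε) → x ≤ 0#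
  ≤-small⇒≤0 bound = ≤max-small⇒≤ ≤-refl λ ε 0<ε → ≤-trans (bound ε 0<ε) (x≤y⊔x 0# ε)

  -- The maximum with 1 makes the statement cover c = 0 as well.
  small-multiple : ∀ c {ε} → 0# < ε → ∃[ δ ] (0# < δ × c * δ < ε)
  small-multiple c {ε} 0<ε with positive-inverse (<-≤-trans 0<1 (x≤y⊔x c 1#))
  ... | d , 0<d , eq = d * (½ * ε) , 0<δ , (begin-strict
    c * (d * (½ * ε))           ≤⟨ c*δ≤max*δ ⟩
    max c 1# * (d * (½ * ε))    ≈⟨ *-assoc (max c 1#) d (½ * ε) ⟨
    max c 1# * d * (½ * ε)      ≈⟨ *-congʳ eq ⟩
    1# * (½ * ε)                ≈⟨ *-identityˡ (½ * ε) ⟩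
    ½ * ε                       <⟨ ½*x<x 0<ε ⟩
    ε                           ∎)
    where
    0<δ : 0# < d * (½ * ε)
    0<δ = *-positive 0<d (*-positive 0<½ 0<ε)
    c*δ≤max*δ : c * (d * (½ * ε)) ≤ max c 1# * (d * (½ * ε))
    c*δ≤max*δ = begin
      c * (d * (½ * ε))          ≈⟨ *-comm c _ ⟩
      d * (½ * ε) * c            ≤⟨ *-monoʳ-≤ (proj₁ 0<δ) (x≤x⊔y c 1#) ⟩
      d * (½ * ε) * max c 1#     ≈⟨ *-comm (max c 1#) _ ⟨
      max c 1# * (d * (½ * ε))   ∎

  inf : ∀ (S : Pred Carrier ℓ) → Satisfiable S → ∃ (IsLowerBound S) → ∃ (IsInf S)
  inf S (x , Sx) bounded with sup (IsLowerBound S) bounded (x , λ b lb → lb x Sx)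
  ... | s , ub , least = s , (λ y Sy → least y (λ b lb → lb y Sy)) , ub

  inf-approx : ∀ {S s t} → IsInf S s → s < t → ∃[ x ] (S x × x < t)
  inf-approx {S} {s} {t} (_ , greatest) s<t = decidable-stable em λ none →
    <⇒≱ s<t (greatest t λ x Sx → ≮⇒≥ λ x<t → none (x , Sx , x<t))

  -- Moves a positive constant out of an infimum without forming the scaled set: b/c, written
  -- `d * b`, is a lower bound of S.
  ≤-scaled-inf : ∀ {S s b c} → IsInf S s → 0# < c → (∀ x → S x → b ≤ c * x) → b ≤ c * s
  ≤-scaled-inf {S} {s} {b} {c} (_ , greatest) 0<c lower with positive-inverse 0<c
  ... | d , 0<d , cd≈1 = begin
    b              ≈⟨ c*[d*x]≈x b ⟨
    c * (d * b)    ≤⟨ *-monoʳ-≤ (proj₁ 0<c) (greatest (d * b) λ x Sx → *-cancelˡ-≤ 0<c (begin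
                        c * (d * b)   ≈⟨ c*[d*x]≈x b ⟩
                        b             ≤⟨ lower x Sx ⟩
                        c * x         ∎)) ⟩
    c * s          ∎
    where
    c*[d*x]≈x : ∀ x → c * (d * x) ≈ x
    c*[d*x]≈x x = trans (sym (*-assoc c d x)) (trans (*-congʳ cd≈1) (*-identityˡ x))

  common-lower : ∀ {x y} → 0# < x → 0# < y → ∃[ z ] (0# < z × z ≤ x × z ≤ y)
  common-lower {x} {y} 0<x 0<y with total x y
  ... | inj₁ x≤y = x , 0<x , ≤-refl , x≤y
  ... | inj₂ y≤x = y , 0<y , y≤x , ≤-refl

  x<x+1 : ∀ x → x < x + 1#
  x<x+1 x = begin-strict
    x        ≈⟨ +-identityʳ x ⟨
    x + 0#   <⟨ +-monoʳ-< x 0<1 ⟩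
    x + 1#   ∎

  -- The accuracy r/2ⁿ reached after n approximation steps.
  halving : Carrier → ℕ → Carrier
  halving r 0ℕ    = r
  halving r (1+ n) = ½ * halving r n

  halving-positive : ∀ {r} → 0# < r → ∀ n → 0# < halving r n
  halving-positive 0<r 0ℕ    = 0<r
  halving-positive 0<r (1+ n) = *-positive 0<½ (halving-positive 0<r n)

  halving-antitone : ∀ {r} → 0# < r → ∀ {m n} → m ≤ℕ n → halving r n ≤ halving r m
  halving-antitone {r} 0<r {m} {n} = go ∘ ℕ.≤⇒≤′
    where
    go : ∀ {n} → m ≤′ n → halving r n ≤ halving r m
    go ≤′-refl           = ≤-refl
    go (≤′-step {n} m≤n) = ≤-trans (proj₁ (½*x<x (halving-positive 0<r n))) (go m≤n)

  -- Twice a lower bound of the sequence is again one, so the infimum s satisfies 2s ≤ s.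
  halving-small : ∀ r → 0# < r → ∀ ε → 0# < ε → ∃[ n ] halving r n < ε
  halving-small r 0<r ε 0<ε = decidable-stable em λ none →
    let bound n = ≮⇒≥ λ lt → none (n , lt)
        s , ub , least = sup S (ε , bound) (r , λ b lb → lb 0)
        lower n = least (halving r n) λ b lb → lb n
        2s≤s = ub (2# * s) λ n → begin
          2# * s                   ≤⟨ *-monoʳ-≤ (proj₁ 0<2) (lower (1+ n)) ⟩
          2# * (½ * halving r n)   ≈⟨ 2*½*x≈x (halving r n) ⟩
          halving r n              ∎
        0<s = <-≤-trans 0<ε (ub ε bound)
    in <⇒≱ (½*x<x (*-positive 0<2 0<s)) (begin
          2# * s         ≤⟨ 2s≤s ⟩
          s              ≈⟨ ½*[x+x]≈x s ⟨
          ½ * (s + s)    ≈⟨ *-congˡ (2*x≈x+x s) ⟨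
          ½ * (2# * s)   ∎)
    where
    S : Pred Carrier ℓ
    S b = ∀ n → b ≤ halving r n

-- Identities for subtraction in a vector space

module VectorSpaceProperties {ℓ : Level} {ℝ : RealNumbers ℓ} {K : ValuedField ℝ ℓ}
                             (W : VectorSpace K) where
  private
    module K = ValuedField K
    module KP = RingProperties K.ring
  open Module W public
  open AbelianGroupProperties +ᴹ-abelianGroup public
    using () renaming (⁻¹-anti-homo‿- to -ᴹ-anti-homo; ⁻¹-∙-comm to -ᴹ-+ᴹ-comm;
                       x∙y⁻¹≈ε⇒x≈y to x-y≈0⇒x≈y; ε⁻¹≈ε to -0≈0; x≈y⇒x∙y⁻¹≈ε to x≈y⇒x-y≈0)
  open CommutativeSemigroupProperties (CommutativeMonoid.commutativeSemigroup +ᴹ-commutativeMonoid)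
    public using () renaming (interchange to +ᴹ-interchange)
  open SetoidReasoning ≈ᴹ-setoid

  infixl 6 _−_
  _−_ : Carrierᴹ → Carrierᴹ → Carrierᴹ
  x − y = x +ᴹ (-ᴹ y)

  −-cong : ∀ {x x′ y y′} → x ≈ᴹ x′ → y ≈ᴹ y′ → x − y ≈ᴹ x′ − y′
  −-cong x≈ y≈ = +ᴹ-cong x≈ (-ᴹ‿cong y≈)

  +ᴹ-−-interchange : ∀ x y x′ y′ → (x +ᴹ y) − (x′ +ᴹ y′) ≈ᴹ (x − x′) +ᴹ (y − y′)
  +ᴹ-−-interchange x y x′ y′ = begin
    (x +ᴹ y) +ᴹ (-ᴹ (x′ +ᴹ y′))         ≈⟨ +ᴹ-congˡ (-ᴹ-+ᴹ-comm x′ y′) ⟨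
    (x +ᴹ y) +ᴹ ((-ᴹ x′) +ᴹ (-ᴹ y′))    ≈⟨ +ᴹ-interchange x y (-ᴹ x′) (-ᴹ y′) ⟩
    (x − x′) +ᴹ (y − y′)                ∎

  [x−y]+y≈x : ∀ x y → (x − y) +ᴹ y ≈ᴹ x
  [x−y]+y≈x x y = begin
    (x − y) +ᴹ y           ≈⟨ +ᴹ-assoc x (-ᴹ y) y ⟩
    x +ᴹ ((-ᴹ y) +ᴹ y)     ≈⟨ +ᴹ-congˡ (-ᴹ‿inverseˡ y) ⟩
    x +ᴹ 0ᴹ                ≈⟨ +ᴹ-identityʳ x ⟩
    x                      ∎

  y+[x−y]≈x : ∀ x y → y +ᴹ (x − y) ≈ᴹ x
  y+[x−y]≈x x y = ≈ᴹ-trans (+ᴹ-comm y (x − y)) ([x−y]+y≈x x y)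

  −-telescope : ∀ x y z → (x − y) +ᴹ (y − z) ≈ᴹ x − z
  −-telescope x y z = begin
    (x − y) +ᴹ (y − z)     ≈⟨ +ᴹ-assoc (x − y) y (-ᴹ z) ⟨
    ((x − y) +ᴹ y) − z     ≈⟨ +ᴹ-congʳ ([x−y]+y≈x x y) ⟩
    x − z                  ∎

  −-assoc : ∀ x y z → x − (y +ᴹ z) ≈ᴹ (x − z) − y
  −-assoc x y z = begin
    x − (y +ᴹ z)                 ≈⟨ +ᴹ-congˡ (-ᴹ-+ᴹ-comm y z) ⟨
    x +ᴹ ((-ᴹ y) +ᴹ (-ᴹ z))      ≈⟨ +ᴹ-congˡ (+ᴹ-comm (-ᴹ y) (-ᴹ z)) ⟩
    x +ᴹ ((-ᴹ z) +ᴹ (-ᴹ y))      ≈⟨ +ᴹ-assoc x (-ᴹ z) (-ᴹ y) ⟨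
    (x − z) − y                  ∎

  [x+y]−y≈x : ∀ x y → (x +ᴹ y) − y ≈ᴹ x
  [x+y]−y≈x x y = ≈ᴹ-trans (+ᴹ-assoc x y (-ᴹ y))
    (≈ᴹ-trans (+ᴹ-congˡ (-ᴹ‿inverseʳ y)) (+ᴹ-identityʳ x))

  x−0≈x : ∀ x → x − 0ᴹ ≈ᴹ x
  x−0≈x x = ≈ᴹ-trans (+ᴹ-congˡ -0≈0) (+ᴹ-identityʳ x)

  -1*x≈-x : ∀ x → (K.- K.1#) *ₗ x ≈ᴹ -ᴹ x
  -1*x≈-x x = ModuleProperties.inverseˡ-uniqueᴹ W _ x (begin
    (K.- K.1#) *ₗ x +ᴹ x           ≈⟨ +ᴹ-congˡ (*ₗ-identityˡ x) ⟨
    (K.- K.1#) *ₗ x +ᴹ K.1# *ₗ x   ≈⟨ *ₗ-distribʳ x (K.- K.1#) K.1# ⟨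
    (K.- K.1# K.+ K.1#) *ₗ x       ≈⟨ *ₗ-congʳ (K.-‿inverseˡ K.1#) ⟩
    K.0# *ₗ x                      ≈⟨ *ₗ-zeroˡ x ⟩
    0ᴹ                             ∎)

  *ₗ-neg : ∀ a x → a *ₗ (-ᴹ x) ≈ᴹ -ᴹ (a *ₗ x)
  *ₗ-neg a x = ModuleProperties.inverseˡ-uniqueᴹ W _ _ (begin
    a *ₗ (-ᴹ x) +ᴹ a *ₗ x   ≈⟨ *ₗ-distribˡ a (-ᴹ x) x ⟨
    a *ₗ ((-ᴹ x) +ᴹ x)      ≈⟨ *ₗ-congˡ (-ᴹ‿inverseˡ x) ⟩
    a *ₗ 0ᴹ                 ≈⟨ *ₗ-zeroʳ a ⟩
    0ᴹ                      ∎)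

  *ₗ-−-distribˡ : ∀ a x y → a *ₗ (x − y) ≈ᴹ a *ₗ x − a *ₗ y
  *ₗ-−-distribˡ a x y = ≈ᴹ-trans (*ₗ-distribˡ a x (-ᴹ y)) (+ᴹ-congˡ (*ₗ-neg a y))

  *ₗ-−-distribʳ : ∀ a b x → (a K.- b) *ₗ x ≈ᴹ a *ₗ x − b *ₗ x
  *ₗ-−-distribʳ a b x = begin
    (a K.- b) *ₗ x                         ≈⟨ *ₗ-distribʳ x a (K.- b) ⟩
    a *ₗ x +ᴹ (K.- b) *ₗ x                 ≈⟨ +ᴹ-congˡ (*ₗ-congʳ (KP.-1*x≈-x b)) ⟨
    a *ₗ x +ᴹ (K.- K.1# K.* b) *ₗ x        ≈⟨ +ᴹ-congˡ (*ₗ-assoc (K.- K.1#) b x) ⟩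
    a *ₗ x +ᴹ (K.- K.1#) *ₗ (b *ₗ x)       ≈⟨ +ᴹ-congˡ (-1*x≈-x (b *ₗ x)) ⟩
    a *ₗ x − b *ₗ x                        ∎

-- Absolute values and ultrametric norms

module Valued {ℓ : Level} (em : ExcludedMiddle ℓ) {ℝ : RealNumbers ℓ} (K : ValuedField ℝ ℓ) where
  private
    module ℝ = RealProperties em ℝ
    module K = ValuedField K
  open ℝ using (0#; 1#; _<_; _≤_; max)
  open ℝ.≤-Reasoning

  abs-positive : ∀ {a} → ¬ a K.≈ K.0# → 0# < K.abs a
  abs-positive {a} a≉0 = K.abs-nonneg a , a≉0 ∘ K.abs-definite a ∘ ℝ.sym

  abs-1 : K.abs K.1# ℝ.≈ 1#
  abs-1 = ℝ.antisym (cancel (ℝ.≤-reflexive eq)) (cancel (ℝ.≤-reflexive (ℝ.sym eq)))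
    where
    cancel : ∀ {x y} → K.abs K.1# ℝ.* x ≤ K.abs K.1# ℝ.* y → x ≤ y
    cancel = ℝ.*-cancelˡ-≤ (abs-positive (IsField.1≉0 K.isField))
    eq : K.abs K.1# ℝ.* K.abs K.1# ℝ.≈ K.abs K.1# ℝ.* 1#
    eq = begin-equality
      K.abs K.1# ℝ.* K.abs K.1#  ≈⟨ K.abs-* K.1# K.1# ⟨
      K.abs (K.1# K.* K.1#)      ≈⟨ K.abs-cong (K.*-identityˡ K.1#) ⟩
      K.abs K.1#                 ≈⟨ ℝ.*-identityʳ _ ⟨
      K.abs K.1# ℝ.* 1#          ∎

  -- If |-1| exceeded 1, it would be at most its own square, which is |1| = 1.
  abs-[-1]≤1 : K.abs (K.- K.1#) ≤ 1#
  abs-[-1]≤1 = ℝ.≮⇒≥ λ 1<∣-1∣ → ℝ.<⇒≱ 1<∣-1∣ (begin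
    K.abs (K.- K.1#)                             ≈⟨ ℝ.*-identityʳ _ ⟨
    K.abs (K.- K.1#) ℝ.* 1#                      ≤⟨ ℝ.*-monoʳ-≤ (K.abs-nonneg _) (proj₁ 1<∣-1∣) ⟩
    K.abs (K.- K.1#) ℝ.* K.abs (K.- K.1#)        ≈⟨ K.abs-* _ _ ⟨
    K.abs (K.- K.1# K.* K.- K.1#)                ≈⟨ K.abs-cong (KP.-1*x≈-x (K.- K.1#)) ⟩
    K.abs (K.- K.- K.1#)                         ≈⟨ K.abs-cong (KP.-‿involutive K.1#) ⟩
    K.abs K.1#                                   ≈⟨ abs-1 ⟩
    1#                                           ∎)
    where module KP = RingProperties K.ring

  inverse-abs : ∀ {a b} → a K.* b K.≈ K.1# → K.abs a ℝ.* K.abs b ℝ.≈ 1#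
  inverse-abs {a} {b} ab≈1 = ℝ.trans (ℝ.sym (K.abs-* a b)) (ℝ.trans (K.abs-cong ab≈1) abs-1)

  -- Turns a coefficient bounded by |a| into a times an integral one. For a = 0 the bound forces b =
  -- 0, and the quotient is set to 0.
  divide : ∀ a b → K.abs b ≤ K.abs a → ∃[ c ] (K.abs c ≤ 1# × b K.≈ a K.* c)
  divide a b ∣b∣≤∣a∣ with em {P = a K.≈ K.0#}
  ... | yes a≈0 = K.0# , ℝ.≤-trans (ℝ.≤-reflexive K.abs-0) ℝ.0≤1 , K.trans b≈0 (K.sym (K.zeroʳ a))
    where
    b≈0 : b K.≈ K.0#
    b≈0 = K.abs-definite b (ℝ.antisym (begin
      K.abs b     ≤⟨ ∣b∣≤∣a∣ ⟩
      K.abs a     ≈⟨ K.abs-cong a≈0 ⟩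
      K.abs K.0#  ≈⟨ K.abs-0 ⟩
      0#          ∎) (K.abs-nonneg b))
  ... | no a≉0 with IsField.inverse K.isField a a≉0
  ...   | a⁻¹ , aa⁻¹≈1 = a⁻¹ K.* b , ℝ.*-cancelˡ-≤ (abs-positive a≉0) (begin
      K.abs a ℝ.* K.abs (a⁻¹ K.* b)   ≈⟨ K.abs-* a _ ⟨
      K.abs (a K.* (a⁻¹ K.* b))       ≈⟨ K.abs-cong a[a⁻¹b]≈b ⟩
      K.abs b                         ≤⟨ ∣b∣≤∣a∣ ⟩
      K.abs a                         ≈⟨ ℝ.*-identityʳ _ ⟨
      K.abs a ℝ.* 1#                  ∎) , K.sym a[a⁻¹b]≈b
    where
    a[a⁻¹b]≈b : a K.* (a⁻¹ K.* b) K.≈ b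
    a[a⁻¹b]≈b = K.trans (K.sym (K.*-assoc a a⁻¹ b)) (K.trans (K.*-congʳ aa⁻¹≈1) (K.*-identityˡ b))

  -- Treats the field as a normed line over itself, so that the lemmas on norms and on limits also
  -- apply to coefficients.
  absNorm : Norm {K = K} TensorUnit.⟨module⟩
  absNorm = record
    { ‖_‖         = K.abs
    ; ‖‖-cong     = K.abs-cong
    ; nonneg      = K.abs-nonneg
    ; definite    = K.abs-definite
    ; homogeneous = K.abs-*
    ; ultrametric = K.abs-ultrametric
    }

  module NormProperties {W : VectorSpace K} (N : Norm {K = K} W) where
    open VectorSpaceProperties {K = K} W
    open Norm N

    ‖0‖≈0 : ‖ 0ᴹ ‖ ℝ.≈ 0#
    ‖0‖≈0 = begin-equality
      ‖ 0ᴹ ‖                    ≈⟨ ‖‖-cong (*ₗ-zeroˡ 0ᴹ) ⟨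
      ‖ K.0# *ₗ 0ᴹ ‖            ≈⟨ homogeneous K.0# 0ᴹ ⟩
      K.abs K.0# ℝ.* ‖ 0ᴹ ‖     ≈⟨ ℝ.*-congʳ K.abs-0 ⟩
      0# ℝ.* ‖ 0ᴹ ‖             ≈⟨ ℝ.zeroˡ _ ⟩
      0#                        ∎

    ‖≈0‖≈0 : ∀ {x} → x ≈ᴹ 0ᴹ → ‖ x ‖ ℝ.≈ 0#
    ‖≈0‖≈0 x≈0 = ℝ.trans (‖‖-cong x≈0) ‖0‖≈0

    positive : ∀ {x} → ¬ x ≈ᴹ 0ᴹ → 0# < ‖ x ‖
    positive {x} x≉0 = nonneg x , x≉0 ∘ definite x ∘ ℝ.sym

    ‖-x‖≤‖x‖ : ∀ x → ‖ -ᴹ x ‖ ≤ ‖ x ‖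
    ‖-x‖≤‖x‖ x = begin
      ‖ -ᴹ x ‖                        ≈⟨ ‖‖-cong (-1*x≈-x x) ⟨
      ‖ (K.- K.1#) *ₗ x ‖             ≈⟨ homogeneous _ x ⟩
      K.abs (K.- K.1#) ℝ.* ‖ x ‖      ≈⟨ ℝ.*-comm _ _ ⟩
      ‖ x ‖ ℝ.* K.abs (K.- K.1#)      ≤⟨ ℝ.*-monoʳ-≤ (nonneg x) abs-[-1]≤1 ⟩
      ‖ x ‖ ℝ.* 1#                    ≈⟨ ℝ.*-identityʳ _ ⟩
      ‖ x ‖                           ∎

    dist-sym-≤ : ∀ x y → dist x y ≤ dist y x
    dist-sym-≤ x y = begin
      ‖ x − y ‖          ≈⟨ ‖‖-cong (-ᴹ-anti-homo y x) ⟨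
      ‖ -ᴹ (y − x) ‖     ≤⟨ ‖-x‖≤‖x‖ (y − x) ⟩
      ‖ y − x ‖          ∎

    ‖+‖≤ : ∀ {x y r} → ‖ x ‖ ≤ r → ‖ y ‖ ≤ r → ‖ x +ᴹ y ‖ ≤ r
    ‖+‖≤ {x} {y} x≤r y≤r = ℝ.≤-trans (ultrametric x y) (ℝ.⊔-lub x≤r y≤r)

    ‖+‖< : ∀ {x y r} → ‖ x ‖ < r → ‖ y ‖ < r → ‖ x +ᴹ y ‖ < r
    ‖+‖< {x} {y} x<r y<r = ℝ.≤-<-trans (ultrametric x y) (ℝ.max-<-lub x<r y<r)

    dist-≤ : ∀ {x y z r} → dist x y ≤ r → dist y z ≤ r → dist x z ≤ r
    dist-≤ {x} {y} {z} {r} xy≤r yz≤r = begin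
      ‖ x − z ‖                 ≈⟨ ‖‖-cong (−-telescope x y z) ⟨
      ‖ (x − y) +ᴹ (y − z) ‖    ≤⟨ ‖+‖≤ xy≤r yz≤r ⟩
      r                         ∎

    dist-< : ∀ {x y z r} → dist x y < r → dist y z < r → dist x z < r
    dist-< {x} {y} {z} {r} xy<r yz<r = begin-strict
      ‖ x − z ‖                 ≈⟨ ‖‖-cong (−-telescope x y z) ⟨
      ‖ (x − y) +ᴹ (y − z) ‖    <⟨ ‖+‖< xy<r yz<r ⟩
      r                         ∎

    ‖x‖≤max : ∀ x y → ‖ x ‖ ≤ max ‖ y ‖ (dist x y)
    ‖x‖≤max x y = begin
      ‖ x ‖                     ≈⟨ ‖‖-cong (y+[x−y]≈x x y) ⟨
      ‖ y +ᴹ (x − y) ‖          ≤⟨ ultrametric y (x − y) ⟩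
      max ‖ y ‖ (dist x y)      ∎

    ‖x‖≤ : ∀ {x y r} → ‖ y ‖ ≤ r → dist x y ≤ r → ‖ x ‖ ≤ r
    ‖x‖≤ {x} {y} y≤r xy≤r = ℝ.≤-trans (‖x‖≤max x y) (ℝ.⊔-lub y≤r xy≤r)

    ‖x‖< : ∀ {x y r} → ‖ y ‖ < r → dist x y < r → ‖ x ‖ < r
    ‖x‖< {x} {y} y<r xy<r = ℝ.≤-<-trans (‖x‖≤max x y) (ℝ.max-<-lub y<r xy<r)

    dist-small⇒≈ : ∀ {x y} → (∀ ε → 0# < ε → dist x y ≤ ε) → x ≈ᴹ y
    dist-small⇒≈ {x} {y} small = x-y≈0⇒x≈y x y
      (definite _ (ℝ.antisym (ℝ.≤-small⇒≤0 small) (nonneg _)))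

    open Metric ℝ dist using (_ConvergesTo_; IsCauchy)

    limit-unique : ∀ {x l m} → x ConvergesTo l → x ConvergesTo m → l ≈ᴹ m
    limit-unique {x} {l} {m} x→l x→m = dist-small⇒≈ λ ε 0<ε →
      let M , close = x→l ε 0<ε
          N , close′ = x→m ε 0<ε
          n = M ⊔ℕ N
      in dist-≤ (ℝ.≤-trans (dist-sym-≤ _ _) (proj₁ (close n (ℕ.m≤m⊔n M N))))
                (proj₁ (close′ n (ℕ.m≤n⊔m M N)))

    module _ {r : ℝ.Carrier} (0<r : 0# < r) (s : ℕ → Carrierᴹ)
             (step : ∀ n → dist (s (1+ n)) (s n) ≤ ℝ.halving r n) where

      -- The distance across many steps is at most the largest single step, which is the earliest;
      -- no geometric series is summed, so the bound loses no factor 2.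
      halving-steps-≤ : ∀ {m n} → m ≤ℕ n → dist (s n) (s m) ≤ ℝ.halving r m
      halving-steps-≤ {m} = go ∘ ℕ.≤⇒≤′
        where
        go : ∀ {n} → m ≤′ n → dist (s n) (s m) ≤ ℝ.halving r m
        go ≤′-refl           = ℝ.≤-trans (ℝ.≤-reflexive (‖≈0‖≈0 (-ᴹ‿inverseʳ (s m))))
                                 (proj₁ (ℝ.halving-positive 0<r m))
        go (≤′-step {n} m≤n) =
          dist-≤ (ℝ.≤-trans (step n) (ℝ.halving-antitone 0<r (ℕ.≤′⇒≤ m≤n))) (go m≤n)

      halving-steps-cauchy : IsCauchy s
      halving-steps-cauchy ε 0<ε =
        let N , small = ℝ.halving-small r 0<r ε 0<ε
        in N , λ m n N≤m N≤n → ℝ.≤-<-trans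
             (dist-≤ (halving-steps-≤ N≤m) (ℝ.≤-trans (dist-sym-≤ _ _) (halving-steps-≤ N≤n))) small

      -- The rate of convergence is part of the result: its case n = 0 later bounds the norm of a
      -- limit, and large n serve to identify it.
      halving-steps-limit : IsComplete → ∃[ l ] (∀ n → dist l (s n) ≤ ℝ.halving r n)
      halving-steps-limit complete =
        let l , s→l = complete s halving-steps-cauchy
        in l , λ n → ℝ.≤max-small⇒≤ (proj₁ (ℝ.halving-positive 0<r n)) λ ε 0<ε →
        let N , close = s→l ε 0<ε
            m = N ⊔ℕ n
        in dist-≤ (ℝ.≤-trans (dist-sym-≤ _ _)
                     (ℝ.≤-trans (proj₁ (close m (ℕ.m≤m⊔n N n))) (ℝ.x≤y⊔x _ _)))
                  (ℝ.≤-trans (halving-steps-≤ (ℕ.m≤n⊔m N n)) (ℝ.x≤x⊔y _ _))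

-- Norms defined as infima of admissible bounds

module InfimumNorms {ℓ : Level} (em : ExcludedMiddle ℓ) {ℝ : RealNumbers ℓ} (K : ValuedField ℝ ℓ) where
  private
    module ℝ = RealProperties em ℝ
    module K = ValuedField K
  open Valued em K
  open ℝ using (0#; 1#; _<_; _≤_; max)
  open ℝ.≤-Reasoning

  -- `P x r` reads as: r is an admissible bound for x. Three norms arise as infima of admissible
  -- bounds: the norm of a completion, the gauge of the lattice, and the comparison norm that tests
  -- local maximality.
  record IsGauge (W : VectorSpace K) (P : Module.Carrierᴹ W → ℝ.Carrier → Set ℓ) : Set ℓ where
    open Module W
    field
      resp       : ∀ {x y r} → x ≈ᴹ y → P x r → P y r
      nonneg     : ∀ {x r} → P x r → 0# ≤ r
      inhabited  : ∀ x → ∃ (P x)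
      scaled     : ∀ a {x r} → P x r → P (a *ₗ x) (K.abs a ℝ.* r)
      summed     : ∀ {x y r s} → P x r → P y s → P (x +ᴹ y) (max r s)
      definite   : ∀ {x} → (∀ ε → 0# < ε → ∃[ r ] (P x r × r < ε)) → x ≈ᴹ 0ᴹ

  module InfimumNorm {W : VectorSpace K} {P : Module.Carrierᴹ W → ℝ.Carrier → Set ℓ}
                     (gauge : IsGauge W P) where
    open Module W
    module P = IsGauge gauge

    infimum : ∀ x → ∃ (ℝ.IsInf (P x))
    infimum x = ℝ.inf (P x) (P.inhabited x) (0# , λ _ → P.nonneg)

    ‖_‖ : Carrierᴹ → ℝ.Carrier
    ‖ x ‖ = proj₁ (infimum x)

    isInf : ∀ x → ℝ.IsInf (P x) ‖ x ‖
    isInf x = proj₂ (infimum x)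

    ‖‖≤ : ∀ {x r} → P x r → ‖ x ‖ ≤ r
    ‖‖≤ {x} = proj₁ (isInf x) _

    ≤‖‖ : ∀ {x b} → (∀ {r} → P x r → b ≤ r) → b ≤ ‖ x ‖
    ≤‖‖ {x} {b} lower = proj₂ (isInf x) b λ _ → lower

    resp-≤ : ∀ {x y} → x ≈ᴹ y → ‖ x ‖ ≤ ‖ y ‖
    resp-≤ x≈y = ≤‖‖ (‖‖≤ ∘ P.resp (≈ᴹ-sym x≈y))

    ‖‖-nonneg : ∀ x → 0# ≤ ‖ x ‖
    ‖‖-nonneg x = ≤‖‖ P.nonneg

    a≈0⇒∣a∣*t≈0 : ∀ {a} t → a K.≈ K.0# → K.abs a ℝ.* t ℝ.≈ 0#
    a≈0⇒∣a∣*t≈0 t a≈0 = ℝ.trans (ℝ.*-congʳ (ℝ.trans (K.abs-cong a≈0) K.abs-0)) (ℝ.zeroˡ t)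

    scale-zero : ∀ {a} x → a K.≈ K.0# → ‖ a *ₗ x ‖ ≤ 0#
    scale-zero {a} x a≈0 = ℝ.≤-trans (‖‖≤ (P.scaled a (proj₂ (P.inhabited x))))
      (ℝ.≤-reflexive (a≈0⇒∣a∣*t≈0 _ a≈0))

    -- Scaling by the inverse b turns an admissible bound r of `a *ₗ x` into the bound |b| r of x.
    -- The opposite inequality is the same statement with a and b exchanged, applied at `a *ₗ x`.
    scale-inverse-≤ : ∀ {a b} x → a K.* b K.≈ K.1# → K.abs a ℝ.* ‖ x ‖ ≤ ‖ a *ₗ x ‖
    scale-inverse-≤ {a} {b} x ab≈1 = ≤‖‖ λ {r} Pax → begin
      K.abs a ℝ.* ‖ x ‖                  ≤⟨ ℝ.*-monoʳ-≤ (K.abs-nonneg a) (‖‖≤ (P.resp b[ax]≈x (P.scaled b Pax))) ⟩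
      K.abs a ℝ.* (K.abs b ℝ.* r)        ≈⟨ ℝ.*-assoc _ _ _ ⟨
      K.abs a ℝ.* K.abs b ℝ.* r          ≈⟨ ℝ.*-congʳ (inverse-abs ab≈1) ⟩
      1# ℝ.* r                           ≈⟨ ℝ.*-identityˡ r ⟩
      r                                  ∎
      where
      b[ax]≈x : b *ₗ (a *ₗ x) ≈ᴹ x
      b[ax]≈x = ≈ᴹ-trans (≈ᴹ-sym (*ₗ-assoc b a x))
        (≈ᴹ-trans (*ₗ-congʳ (K.trans (K.*-comm b a) ab≈1)) (*ₗ-identityˡ x))

    scale-≤ : ∀ a x → K.abs a ℝ.* ‖ x ‖ ≤ ‖ a *ₗ x ‖
    scale-≤ a x with em {P = a K.≈ K.0#}
    ... | yes a≈0 = ℝ.≤-trans (ℝ.≤-reflexive (a≈0⇒∣a∣*t≈0 _ a≈0)) (‖‖-nonneg _)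
    ... | no  a≉0 = scale-inverse-≤ x (proj₂ (IsField.inverse K.isField a a≉0))

    scale-≥ : ∀ a x → ‖ a *ₗ x ‖ ≤ K.abs a ℝ.* ‖ x ‖
    scale-≥ a x with em {P = a K.≈ K.0#}
    ... | yes a≈0 = ℝ.≤-trans (scale-zero x a≈0) (ℝ.≤-reflexive (ℝ.sym (a≈0⇒∣a∣*t≈0 _ a≈0)))
    ... | no  a≉0 = begin
      ‖ a *ₗ x ‖                            ≈⟨ ℝ.*-identityˡ _ ⟨
      1# ℝ.* ‖ a *ₗ x ‖                     ≈⟨ ℝ.*-congʳ (inverse-abs aa⁻¹≈1) ⟨
      K.abs a ℝ.* K.abs a⁻¹ ℝ.* ‖ a *ₗ x ‖   ≈⟨ ℝ.*-assoc _ _ _ ⟩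
      K.abs a ℝ.* (K.abs a⁻¹ ℝ.* ‖ a *ₗ x ‖) ≤⟨ ℝ.*-monoʳ-≤ (K.abs-nonneg a)
                                               (scale-inverse-≤ (a *ₗ x) a⁻¹a≈1) ⟩
      K.abs a ℝ.* ‖ a⁻¹ *ₗ (a *ₗ x) ‖        ≤⟨ ℝ.*-monoʳ-≤ (K.abs-nonneg a) (resp-≤ a⁻¹[ax]≈x) ⟩
      K.abs a ℝ.* ‖ x ‖                     ∎
      where
      a⁻¹ = proj₁ (IsField.inverse K.isField a a≉0)
      aa⁻¹≈1 = proj₂ (IsField.inverse K.isField a a≉0)
      a⁻¹a≈1 = K.trans (K.*-comm a⁻¹ a) aa⁻¹≈1
      a⁻¹[ax]≈x : a⁻¹ *ₗ (a *ₗ x) ≈ᴹ x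
      a⁻¹[ax]≈x = ≈ᴹ-trans (≈ᴹ-sym (*ₗ-assoc a⁻¹ a x))
        (≈ᴹ-trans (*ₗ-congʳ a⁻¹a≈1) (*ₗ-identityˡ x))

    abstract
      norm : Norm {K = K} W
      norm = record
        { ‖_‖         = ‖_‖
        ; ‖‖-cong     = λ x≈y → ℝ.antisym (resp-≤ x≈y) (resp-≤ (≈ᴹ-sym x≈y))
        ; nonneg      = ‖‖-nonneg
        ; definite    = λ x ‖x‖≈0 → P.definite λ ε 0<ε →
            ℝ.inf-approx (isInf x) (ℝ.≤-<-trans (ℝ.≤-reflexive ‖x‖≈0) 0<ε)
        ; homogeneous = λ a x → ℝ.antisym (scale-≥ a x) (scale-≤ a x)
        -- If the maximum were smaller than ‖x + y‖, both x and y would have admissible bounds below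
        -- ‖x + y‖, and the larger of these would be admissible for the sum.
        ; ultrametric = λ x y → ℝ.≮⇒≥ λ max<‖x+y‖ →
            let r , Pxr , r< = ℝ.inf-approx (isInf x) (ℝ.≤-<-trans (ℝ.x≤x⊔y _ _) max<‖x+y‖)
                s , Pys , s< = ℝ.inf-approx (isInf y) (ℝ.≤-<-trans (ℝ.x≤y⊔x _ _) max<‖x+y‖)
            in ℝ.<⇒≱ (ℝ.max-<-lub r< s<) (‖‖≤ (P.summed Pxr Pys))
        }

      norm-isInf : ∀ x → ℝ.IsInf (P x) (Norm.‖_‖ norm x)
      norm-isInf = isInf

    norm-≤ : ∀ {x r} → P x r → Norm.‖_‖ norm x ≤ r
    norm-≤ {x} = proj₁ (norm-isInf x) _

    ≤-norm : ∀ {x b} → (∀ {r} → P x r → b ≤ r) → b ≤ Norm.‖_‖ norm x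
    ≤-norm {x} {b} lower = proj₂ (norm-isInf x) b λ _ → lower

-- Completion of a normed space by Cauchy sequences

module CauchyCompletion {ℓ : Level} (em : ExcludedMiddle ℓ) {ℝ : RealNumbers ℓ} {K : ValuedField ℝ ℓ}
                        {W : VectorSpace K} (N : Norm {K = K} W) where
  private
    module ℝ = RealProperties em ℝ
    module K = ValuedField K
  open ℝ using (0#; 1#; _<_; _≤_; max; ½)
  open ℝ.≤-Reasoning
  open Valued em K
  open InfimumNorms em K
  open VectorSpaceProperties {K = K} W
  open Norm N
  open NormProperties N
  open Metric ℝ dist using (IsCauchy)

  Null : (ℕ → Carrierᴹ) → Set ℓ
  Null x = ∀ ε → 0# < ε → ∃[ N ] (∀ n → N ≤ℕ n → ‖ x n ‖ < ε)

  null-resp : ∀ {x y} → (∀ n → x n ≈ᴹ y n) → Null x → Null y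
  null-resp x≈y null ε 0<ε =
    let N , small = null ε 0<ε
    in N , λ n N≤n → ℝ.≤-<-trans (ℝ.≤-reflexive (‖‖-cong (≈ᴹ-sym (x≈y n)))) (small n N≤n)

  null-0 : Null (λ _ → 0ᴹ)
  null-0 ε 0<ε = 0 , λ _ _ → ℝ.≤-<-trans (ℝ.≤-reflexive ‖0‖≈0) 0<ε

  null-+ : ∀ {x y} → Null x → Null y → Null (λ n → x n +ᴹ y n)
  null-+ null-x null-y ε 0<ε =
    let M , small = null-x ε 0<ε
        N , small′ = null-y ε 0<ε
    in M ⊔ℕ N , λ n M⊔N≤n → ‖+‖< (small n (ℕ.m⊔n≤o⇒m≤o M N M⊔N≤n))
                                 (small′ n (ℕ.m⊔n≤o⇒n≤o M N M⊔N≤n))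

  null-neg : ∀ {x} → Null x → Null (λ n → -ᴹ x n)
  null-neg {x} null ε 0<ε =
    let N , small = null ε 0<ε
    in N , λ n N≤n → ℝ.≤-<-trans (‖-x‖≤‖x‖ (x n)) (small n N≤n)

  scale-small : ∀ {a ε δ} x → K.abs a ℝ.* δ < ε → ‖ x ‖ < δ → ‖ a *ₗ x ‖ < ε
  scale-small {a} {ε} {δ} x aδ<ε ‖x‖<δ = begin-strict
    ‖ a *ₗ x ‖           ≈⟨ homogeneous a x ⟩
    K.abs a ℝ.* ‖ x ‖    ≤⟨ ℝ.*-monoʳ-≤ (K.abs-nonneg a) (proj₁ ‖x‖<δ) ⟩
    K.abs a ℝ.* δ        <⟨ aδ<ε ⟩
    ε                    ∎

  null-* : ∀ a {x} → Null x → Null (λ n → a *ₗ x n)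
  null-* a {x} null ε 0<ε =
    let δ , 0<δ , aδ<ε = ℝ.small-multiple (K.abs a) 0<ε
        N , small = null δ 0<δ
    in N , λ n N≤n → scale-small (x n) aδ<ε (small n N≤n)

  cauchy-+ : ∀ {x y} → IsCauchy x → IsCauchy y → IsCauchy (λ n → x n +ᴹ y n)
  cauchy-+ {x} {y} cx cy ε 0<ε =
    let M , close = cx ε 0<ε
        N , close′ = cy ε 0<ε
    in M ⊔ℕ N , λ m n M⊔N≤m M⊔N≤n → ℝ.≤-<-trans
         (ℝ.≤-reflexive (‖‖-cong (+ᴹ-−-interchange (x m) (y m) (x n) (y n))))
         (‖+‖< (close m n (ℕ.m⊔n≤o⇒m≤o M N M⊔N≤m) (ℕ.m⊔n≤o⇒m≤o M N M⊔N≤n))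
               (close′ m n (ℕ.m⊔n≤o⇒n≤o M N M⊔N≤m) (ℕ.m⊔n≤o⇒n≤o M N M⊔N≤n)))

  cauchy-neg : ∀ {x} → IsCauchy x → IsCauchy (λ n → -ᴹ x n)
  cauchy-neg {x} cx ε 0<ε =
    let N , close = cx ε 0<ε
    in N , λ m n N≤m N≤n → ℝ.≤-<-trans
         (ℝ.≤-trans (ℝ.≤-reflexive (‖‖-cong (-ᴹ-+ᴹ-comm (x m) (-ᴹ x n)))) (‖-x‖≤‖x‖ _))
         (close m n N≤m N≤n)

  cauchy-* : ∀ a {x} → IsCauchy x → IsCauchy (λ n → a *ₗ x n)
  cauchy-* a {x} cx ε 0<ε =
    let δ , 0<δ , aδ<ε = ℝ.small-multiple (K.abs a) 0<ε
        N , close = cx δ 0<δ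
    in N , λ m n N≤m N≤n → ℝ.≤-<-trans
         (ℝ.≤-reflexive (‖‖-cong (≈ᴹ-sym (*ₗ-−-distribˡ a (x m) (x n)))))
         (scale-small (x m − x n) aδ<ε (close m n N≤m N≤n))

  cauchy-const : ∀ x → IsCauchy (λ _ → x)
  cauchy-const x ε 0<ε = 0 , λ _ _ _ _ →
    ℝ.≤-<-trans (ℝ.≤-reflexive (‖≈0‖≈0 (-ᴹ‿inverseʳ x))) 0<ε

  CauchySequence : Set ℓ
  CauchySequence = ∃ IsCauchy

  infix 4 _≈ᶜ_
  _≈ᶜ_ : CauchySequence → CauchySequence → Set ℓ
  (x , _) ≈ᶜ (y , _) = Null (λ n → x n − y n)

  pointwise : ∀ (x y : CauchySequence) → (∀ n → proj₁ x n ≈ᴹ proj₁ y n) → x ≈ᶜ y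
  pointwise x y x≈y = null-resp (λ n → ≈ᴹ-sym (x≈y⇒x-y≈0 (x≈y n))) null-0

  _+ᶜ_ : CauchySequence → CauchySequence → CauchySequence
  (x , cx) +ᶜ (y , cy) = (λ n → x n +ᴹ y n) , cauchy-+ cx cy

  _*ᶜ_ : K.Carrier → CauchySequence → CauchySequence
  a *ᶜ (x , cx) = (λ n → a *ₗ x n) , cauchy-* a cx

  -ᶜ_ : CauchySequence → CauchySequence
  -ᶜ (x , cx) = (λ n → -ᴹ x n) , cauchy-neg cx

  const : Carrierᴹ → CauchySequence
  const x = (λ _ → x) , cauchy-const x

  ≈ᶜ-refl : ∀ {x} → x ≈ᶜ x
  ≈ᶜ-refl {x} = pointwise x x λ _ → ≈ᴹ-refl

  ≈ᶜ-sym : ∀ {x y} → x ≈ᶜ y → y ≈ᶜ x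
  ≈ᶜ-sym {x , _} {y , _} x≈y = null-resp (λ n → -ᴹ-anti-homo (x n) (y n)) (null-neg x≈y)

  ≈ᶜ-trans : ∀ {x y z} → x ≈ᶜ y → y ≈ᶜ z → x ≈ᶜ z
  ≈ᶜ-trans {x , _} {y , _} {z , _} x≈y y≈z =
    null-resp (λ n → −-telescope (x n) (y n) (z n)) (null-+ x≈y y≈z)

  +ᶜ-cong : ∀ {x y u v} → x ≈ᶜ y → u ≈ᶜ v → (x +ᶜ u) ≈ᶜ (y +ᶜ v)
  +ᶜ-cong {x , _} {y , _} {u , _} {v , _} x≈y u≈v =
    null-resp (λ n → ≈ᴹ-sym (+ᴹ-−-interchange (x n) (u n) (y n) (v n))) (null-+ x≈y u≈v)

  -ᶜ-cong : ∀ {x y} → x ≈ᶜ y → (-ᶜ x) ≈ᶜ (-ᶜ y)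
  -ᶜ-cong {x , _} {y , _} x≈y =
    null-resp (λ n → ≈ᴹ-sym (-ᴹ-+ᴹ-comm (x n) (-ᴹ y n))) (null-neg x≈y)

  *ᶜ-cong : ∀ {a b x y} → a K.≈ b → x ≈ᶜ y → (a *ᶜ x) ≈ᶜ (b *ᶜ y)
  *ᶜ-cong {a} {b} {x , _} {y , _} a≈b x≈y = null-resp
    (λ n → ≈ᴹ-trans (*ₗ-−-distribˡ a (x n) (y n)) (−-cong ≈ᴹ-refl (*ₗ-congʳ a≈b))) (null-* a x≈y)

  space : VectorSpace K
  space = record
    { Carrierᴹ = CauchySequence
    ; _≈ᴹ_ = _≈ᶜ_
    ; _+ᴹ_ = _+ᶜ_
    ; _*ₗ_ = _*ᶜ_
    ; _*ᵣ_ = flip _*ᶜ_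
    ; 0ᴹ = const 0ᴹ
    ; -ᴹ_ = -ᶜ_
    ; isModule = IsModuleFromLeft.isModule {commutativeRing = K.commutativeRing} (record
      { isLeftModule = record
        { isLeftSemimodule = record
          { +ᴹ-isCommutativeMonoid = record
            { isMonoid = record
              { isSemigroup = record
                { isMagma = record
                  { isEquivalence = record
                    { refl = λ {x} → ≈ᶜ-refl {x}
                    ; sym = λ {x} {y} → ≈ᶜ-sym {x} {y}
                    ; trans = λ {x} {y} {z} → ≈ᶜ-trans {x} {y} {z}
                    }
                  ; ∙-cong = λ {x} {y} {u} {v} → +ᶜ-cong {x} {y} {u} {v}
                  }
                ; assoc = λ x y z → pointwise ((x +ᶜ y) +ᶜ z) (x +ᶜ (y +ᶜ z)) λ n → +ᴹ-assoc _ _ _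
                }
              ; identity = (λ x → pointwise (const 0ᴹ +ᶜ x) x λ n → +ᴹ-identityˡ _)
                         , (λ x → pointwise (x +ᶜ const 0ᴹ) x λ n → +ᴹ-identityʳ _)
              }
            ; comm = λ x y → pointwise (x +ᶜ y) (y +ᶜ x) λ n → +ᴹ-comm _ _
            }
          ; isPreleftSemimodule = record
            { *ₗ-cong = λ {a} {b} {x} {y} → *ᶜ-cong {a} {b} {x} {y}
            ; *ₗ-zeroˡ = λ x → pointwise (K.0# *ᶜ x) (const 0ᴹ) λ n → *ₗ-zeroˡ _
            ; *ₗ-distribʳ = λ x a b → pointwise ((a K.+ b) *ᶜ x) ((a *ᶜ x) +ᶜ (b *ᶜ x)) λ n → *ₗ-distribʳ _ a b
            ; *ₗ-identityˡ = λ x → pointwise (K.1# *ᶜ x) x λ n → *ₗ-identityˡ _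
            ; *ₗ-assoc = λ a b x → pointwise ((a K.* b) *ᶜ x) (a *ᶜ (b *ᶜ x)) λ n → *ₗ-assoc a b _
            ; *ₗ-zeroʳ = λ a → pointwise (a *ᶜ const 0ᴹ) (const 0ᴹ) λ n → *ₗ-zeroʳ a
            ; *ₗ-distribˡ = λ a x y → pointwise (a *ᶜ (x +ᶜ y)) ((a *ᶜ x) +ᶜ (a *ᶜ y)) λ n → *ₗ-distribˡ a _ _
            }
          }
        ; -ᴹ‿cong = λ {x} {y} → -ᶜ-cong {x} {y}
        ; -ᴹ‿inverse = (λ x → pointwise ((-ᶜ x) +ᶜ x) (const 0ᴹ) λ n → -ᴹ‿inverseˡ _)
                     , (λ x → pointwise (x +ᶜ (-ᶜ x)) (const 0ᴹ) λ n → -ᴹ‿inverseʳ _)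
        }
      })
    }

  -- The infimum of these r is the limit of `‖ x n ‖`, obtained without first showing that the norms
  -- converge. The slack ε matters at r = 0, where it makes 0 an admissible bound of every null
  -- sequence, so that bounds depend only on the class of x.
  EventualBound : CauchySequence → ℝ.Carrier → Set ℓ
  EventualBound (x , _) r = 0# ≤ r × (∀ ε → 0# < ε → ∃[ N ] (∀ n → N ≤ℕ n → ‖ x n ‖ ≤ max r ε))

  eventualBound-isGauge : IsGauge space EventualBound
  eventualBound-isGauge = record
    { resp = λ {(x , _)} {(y , _)} {r} x≈y (0≤r , bound) → 0≤r , λ ε 0<ε →
        let M , close = x≈y ε 0<ε
            N , bnd = bound ε 0<ε
        in M ⊔ℕ N , λ n M⊔N≤n → ‖x‖≤ {y n} {x n} (bnd n (ℕ.m⊔n≤o⇒n≤o M N M⊔N≤n))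
             (ℝ.≤-trans (dist-sym-≤ (y n) (x n))
               (ℝ.≤-trans (proj₁ (close n (ℕ.m⊔n≤o⇒m≤o M N M⊔N≤n))) (ℝ.x≤y⊔x r ε)))
    ; nonneg = proj₁
    ; inhabited = λ (x , cx) →
        let N , close = cx 1# ℝ.0<1
        in max ‖ x N ‖ 1# , ℝ.≤-trans (nonneg (x N)) (ℝ.x≤x⊔y _ _) , λ ε 0<ε → N , λ n N≤n →
             ℝ.≤-trans (‖x‖≤ {x n} {x N} (ℝ.x≤x⊔y _ _)
               (ℝ.≤-trans (proj₁ (close n N N≤n ℕ.≤-refl)) (ℝ.x≤y⊔x _ _))) (ℝ.x≤x⊔y _ _)
    ; scaled = λ a {(x , _)} {r} (0≤r , bound) → ℝ.*-nonneg (K.abs-nonneg a) 0≤r , λ ε 0<ε →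
        let δ , 0<δ , aδ<ε = ℝ.small-multiple (K.abs a) 0<ε
            N , bnd = bound δ 0<δ
        in N , λ n N≤n → begin
             ‖ a *ₗ x n ‖                  ≈⟨ homogeneous a (x n) ⟩
             K.abs a ℝ.* ‖ x n ‖           ≤⟨ ℝ.*-monoʳ-≤ (K.abs-nonneg a) (bnd n N≤n) ⟩
             K.abs a ℝ.* max r δ           ≤⟨ ℝ.*-max-≤ (ℝ.x≤x⊔y _ _) (ℝ.≤-trans (proj₁ aδ<ε) (ℝ.x≤y⊔x _ _)) ⟩
             max (K.abs a ℝ.* r) ε         ∎
    ; summed = λ {(x , _)} {(y , _)} {r} {s} (0≤r , bound) (_ , bound′) →
        ℝ.≤-trans 0≤r (ℝ.x≤x⊔y r s) , λ ε 0<ε →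
        let M , bnd = bound ε 0<ε
            N , bnd′ = bound′ ε 0<ε
        in M ⊔ℕ N , λ n M⊔N≤n → ‖+‖≤ {x n} {y n}
             (ℝ.≤-trans (bnd n (ℕ.m⊔n≤o⇒m≤o M N M⊔N≤n)) (ℝ.⊔-mono-≤ (ℝ.x≤x⊔y r s) ℝ.≤-refl))
             (ℝ.≤-trans (bnd′ n (ℕ.m⊔n≤o⇒n≤o M N M⊔N≤n)) (ℝ.⊔-mono-≤ (ℝ.x≤y⊔x r s) ℝ.≤-refl))
    ; definite = λ {(x , _)} small → null-resp (λ n → ≈ᴹ-sym (x−0≈x (x n))) λ ε 0<ε →
        let r , (_ , bound) , r<ε = small ε 0<ε
            ½ε<ε = ℝ.½*x<x 0<ε
            N , bnd = bound (½ ℝ.* ε) (ℝ.*-positive ℝ.0<½ 0<ε)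
        in N , λ n N≤n → ℝ.≤-<-trans (bnd n N≤n) (ℝ.max-<-lub r<ε ½ε<ε)
    }

  module Limit = InfimumNorm eventualBound-isGauge

  norm : Norm {K = K} space
  norm = Limit.norm

  private module C = Norm norm

  ‖‖-eventually-≤ : ∀ (x : CauchySequence) {r} → 0# ≤ r →
                    ∃[ N ] (∀ n → N ≤ℕ n → ‖ proj₁ x n ‖ ≤ r) → C.‖ x ‖ ≤ r
  ‖‖-eventually-≤ x 0≤r (N , bound) =
    Limit.norm-≤ {x} (0≤r , λ ε 0<ε → N , λ n N≤n → ℝ.≤-trans (bound n N≤n) (ℝ.x≤x⊔y _ _))

  const-isometric : ∀ w → C.‖ const w ‖ ℝ.≈ ‖ w ‖
  const-isometric w = ℝ.antisym
    (‖‖-eventually-≤ (const w) (nonneg w) (0 , λ _ _ → ℝ.≤-refl))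
    (Limit.≤-norm {const w} λ (0≤r , bound) → ℝ.≤max-small⇒≤ 0≤r λ ε 0<ε →
      let N , bnd = bound ε 0<ε in bnd N ℕ.≤-refl)

  terms-converge : ∀ (x : CauchySequence) ε → 0# < ε →
                   ∃[ N ] (∀ n → N ≤ℕ n → C.dist (const (proj₁ x n)) x < ε)
  terms-converge (x , cx) ε 0<ε =
    -- An eventual bound yields only a non-strict inequality for the norm, so it is taken at ε/2.
    let 0<½ε = ℝ.*-positive ℝ.0<½ 0<ε
        N , close = cx (½ ℝ.* ε) 0<½ε
    in N , λ n N≤n → ℝ.≤-<-trans
         (‖‖-eventually-≤ (const (x n) +ᶜ (-ᶜ (x , cx))) (proj₁ 0<½ε) (N , λ m N≤m → proj₁ (close n m N≤n N≤m)))
         (ℝ.½*x<x 0<ε)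

  const-dense : Metric.HasDenseImage ℝ C.dist const
  const-dense x ε 0<ε =
    let N , close = terms-converge x ε 0<ε in proj₁ x N , close N ℕ.≤-refl

  const-linear : IsLinear {K = K} W space const
  const-linear = record
    { isBimoduleHomomorphism = record
      { +ᴹ-isGroupHomomorphism = record
        { isMonoidHomomorphism = record
          { isMagmaHomomorphism = record
            { isRelHomomorphism = record { cong = λ {x} {y} x≈y → pointwise (const x) (const y) λ _ → x≈y }
            ; homo = λ x y → ≈ᶜ-refl {const (x +ᴹ y)}
            }
          ; ε-homo = ≈ᶜ-refl {const 0ᴹ}
          }
        ; ⁻¹-homo = λ x → ≈ᶜ-refl {const (-ᴹ x)}
        }
      ; *ₗ-homo = λ a x → ≈ᶜ-refl {const (a *ₗ x)}
      ; *ᵣ-homo = λ a x → pointwise (const (x *ᵣ a)) (const (a *ₗ x)) λ _ → ≈ᴹ-sym (*ₗ-*ᵣ-coincident a x)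
      }
    }

  private module CP = NormProperties norm

  -- Diagonal argument: each `X k` is replaced by one vector `y k` within 2⁻ᵏ of it. The sequence y
  -- is Cauchy because `const` is isometric, and y is itself the limit point.
  complete : C.IsComplete
  complete X cauchy = limit , converges
    where
    approx : ∀ k → ∃[ w ] (C.dist (const w) (X k) < ℝ.halving 1# k)
    approx k = const-dense (X k) (ℝ.halving 1# k) (ℝ.halving-positive ℝ.0<1 k)

    y : ℕ → Carrierᴹ
    y = proj₁ ∘ approx

    approx-< : ∀ {ε k N} → ℝ.halving 1# N < ε → N ≤ℕ k → C.dist (const (y k)) (X k) < ε
    approx-< {ε} {k} small N≤k =
      ℝ.<-trans (proj₂ (approx k)) (ℝ.≤-<-trans (ℝ.halving-antitone ℝ.0<1 N≤k) small)

    y-dist : ∀ m n → dist (y m) (y n) ≤ C.dist (const (y m)) (const (y n))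
    y-dist m n = begin
      ‖ y m − y n ‖                              ≈⟨ const-isometric (y m − y n) ⟨
      C.‖ const (y m − y n) ‖                    ≈⟨ C.‖‖-cong {const (y m − y n)} {const (y m) +ᶜ (-ᶜ const (y n))} (≈ᶜ-refl {const (y m − y n)}) ⟩
      C.‖ const (y m) +ᶜ (-ᶜ const (y n)) ‖      ∎

    y-cauchy : IsCauchy y
    y-cauchy ε 0<ε =
      let M , close = cauchy ε 0<ε
          N , small = ℝ.halving-small 1# ℝ.0<1 ε 0<ε
      in M ⊔ℕ N , λ m n M⊔N≤m M⊔N≤n → ℝ.≤-<-trans (y-dist m n)
           (CP.dist-< {const (y m)} {X m} {const (y n)} (approx-< small (ℕ.m⊔n≤o⇒n≤o M N M⊔N≤m))
             (CP.dist-< {X m} {X n} {const (y n)}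
               (close m n (ℕ.m⊔n≤o⇒m≤o M N M⊔N≤m) (ℕ.m⊔n≤o⇒m≤o M N M⊔N≤n))
               (ℝ.≤-<-trans (CP.dist-sym-≤ (X n) (const (y n)))
                 (approx-< small (ℕ.m⊔n≤o⇒n≤o M N M⊔N≤n)))))

    limit : CauchySequence
    limit = y , y-cauchy

    converges : Metric._ConvergesTo_ ℝ C.dist X limit
    converges ε 0<ε =
      let M , close = terms-converge limit ε 0<ε
          N , small = ℝ.halving-small 1# ℝ.0<1 ε 0<ε
      in M ⊔ℕ N , λ n M⊔N≤n → CP.dist-< {X n} {const (y n)} {limit}
           (ℝ.≤-<-trans (CP.dist-sym-≤ (X n) (const (y n))) (approx-< small (ℕ.m⊔n≤o⇒n≤o M N M⊔N≤n)))
           (close n (ℕ.m⊔n≤o⇒m≤o M N M⊔N≤n))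

  completion : Completion {K = K} N
  completion = record
    { space     = space
    ; norm      = norm
    ; complete  = complete
    ; ι         = const
    ; linear    = const-linear
    ; isometric = const-isometric
    ; dense     = const-dense
    }

  -- Extension of bounded linear maps to the completion

  module Lift {X : VectorSpace K} (NX : Norm {K = K} X) (NX-complete : Norm.IsComplete NX)
              (f : Carrierᴹ → Module.Carrierᴹ X) (f-linear : IsLinear {K = K} W X f)
              (c : ℝ.Carrier) (0<c : 0# < c)
              (f-bounded : ∀ w → Norm.‖_‖ NX (f w) ≤ c ℝ.* ‖ w ‖) where
    private
      module X = VectorSpaceProperties {K = K} X
      module NX = Norm NX
      module XP = NormProperties NX
      module f = IsModuleHomomorphism f-linear
    open Metric ℝ NX.dist using (_ConvergesTo_)

    f-dist-< : ∀ {δ ε x y} → c ℝ.* δ < ε → dist x y < δ → NX.dist (f x) (f y) < ε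
    f-dist-< {δ} {ε} {x} {y} cδ<ε xy<δ = begin-strict
      NX.‖ f x X.− f y ‖       ≈⟨ NX.‖‖-cong (X.+ᴹ-congˡ (f.-ᴹ-homo y)) ⟨
      NX.‖ f x X.+ᴹ f (-ᴹ y) ‖ ≈⟨ NX.‖‖-cong (f.+ᴹ-homo x (-ᴹ y)) ⟨
      NX.‖ f (x − y) ‖         ≤⟨ f-bounded (x − y) ⟩
      c ℝ.* dist x y           ≤⟨ ℝ.*-monoʳ-≤ (proj₁ 0<c) (proj₁ xy<δ) ⟩
      c ℝ.* δ                  <⟨ cδ<ε ⟩
      ε                        ∎

    f-cauchy : ∀ (x : CauchySequence) → Metric.IsCauchy ℝ NX.dist (f ∘ proj₁ x)
    f-cauchy (x , cx) ε 0<ε =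
      let δ , 0<δ , cδ<ε = ℝ.small-multiple c 0<ε
          N , close = cx δ 0<δ
      in N , λ m n N≤m N≤n → f-dist-< cδ<ε (close m n N≤m N≤n)

    lift : CauchySequence → X.Carrierᴹ
    lift x = proj₁ (NX-complete (f ∘ proj₁ x) (f-cauchy x))

    lift-limit : ∀ x → (f ∘ proj₁ x) ConvergesTo lift x
    lift-limit x = proj₂ (NX-complete (f ∘ proj₁ x) (f-cauchy x))

    -- `lift` chooses some limit for each sequence. Congruence, additivity, homogeneity and the
    -- value on constants are all proved by exhibiting the other side as a limit of the same
    -- sequence.
    lift-unique : ∀ x {l} → (f ∘ proj₁ x) ConvergesTo l → lift x X.≈ᴹ l
    lift-unique x = XP.limit-unique (lift-limit x)

    lift-cong : ∀ {x y} → x ≈ᶜ y → lift x X.≈ᴹ lift y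
    lift-cong {x} {y} x≈y = lift-unique x λ ε 0<ε →
      let δ , 0<δ , cδ<ε = ℝ.small-multiple c 0<ε
          M , close = x≈y δ 0<δ
          N , close′ = lift-limit y ε 0<ε
      in M ⊔ℕ N , λ n M⊔N≤n → XP.dist-< {f (proj₁ x n)} {f (proj₁ y n)} {lift y}
           (f-dist-< cδ<ε (close n (ℕ.m⊔n≤o⇒m≤o M N M⊔N≤n)))
           (close′ n (ℕ.m⊔n≤o⇒n≤o M N M⊔N≤n))

    lift-+ : ∀ x y → lift (x +ᶜ y) X.≈ᴹ lift x X.+ᴹ lift y
    lift-+ x y = lift-unique (x +ᶜ y) λ ε 0<ε →
      let M , close = lift-limit x ε 0<ε
          N , close′ = lift-limit y ε 0<ε
      in M ⊔ℕ N , λ n M⊔N≤n → ℝ.≤-<-trans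
           (ℝ.≤-reflexive (NX.‖‖-cong (X.≈ᴹ-trans (X.−-cong (f.+ᴹ-homo _ _) X.≈ᴹ-refl)
             (X.+ᴹ-−-interchange _ _ _ _))))
           (XP.‖+‖< (close n (ℕ.m⊔n≤o⇒m≤o M N M⊔N≤n)) (close′ n (ℕ.m⊔n≤o⇒n≤o M N M⊔N≤n)))

    lift-* : ∀ a x → lift (a *ᶜ x) X.≈ᴹ a X.*ₗ lift x
    lift-* a x = lift-unique (a *ᶜ x) λ ε 0<ε →
      let δ , 0<δ , aδ<ε = ℝ.small-multiple (K.abs a) 0<ε
          N , close = lift-limit x δ 0<δ
      in N , λ n N≤n → begin-strict
           NX.‖ f (a *ₗ proj₁ x n) X.− a X.*ₗ lift x ‖        ≈⟨ NX.‖‖-cong (X.−-cong (f.*ₗ-homo a _) X.≈ᴹ-refl) ⟩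
           NX.‖ a X.*ₗ f (proj₁ x n) X.− a X.*ₗ lift x ‖      ≈⟨ NX.‖‖-cong (X.*ₗ-−-distribˡ a _ _) ⟨
           NX.‖ a X.*ₗ (f (proj₁ x n) X.− lift x) ‖           ≈⟨ NX.homogeneous a _ ⟩
           K.abs a ℝ.* NX.dist (f (proj₁ x n)) (lift x)       ≤⟨ ℝ.*-monoʳ-≤ (K.abs-nonneg a) (proj₁ (close n N≤n)) ⟩
           K.abs a ℝ.* δ                                      <⟨ aδ<ε ⟩
           ε                                                  ∎

    lift-neg : ∀ x → lift (-ᶜ x) X.≈ᴹ X.-ᴹ lift x
    lift-neg x = X.≈ᴹ-trans
      (lift-cong { -ᶜ x} {(K.- K.1#) *ᶜ x} (pointwise (-ᶜ x) ((K.- K.1#) *ᶜ x) λ n → ≈ᴹ-sym (-1*x≈-x (proj₁ x n))))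
      (X.≈ᴹ-trans (lift-* (K.- K.1#) x) (X.-1*x≈-x (lift x)))

    lift-const : ∀ w → lift (const w) X.≈ᴹ f w
    lift-const w = lift-unique (const w) λ ε 0<ε → 0 , λ _ _ →
      ℝ.≤-<-trans (ℝ.≤-reflexive (XP.‖≈0‖≈0 (X.-ᴹ‿inverseʳ (f w)))) 0<ε

    lift-linear : IsLinear {K = K} space X lift
    lift-linear = record
      { isBimoduleHomomorphism = record
        { +ᴹ-isGroupHomomorphism = record
          { isMonoidHomomorphism = record
            { isMagmaHomomorphism = record
              { isRelHomomorphism = record { cong = λ {x} {y} → lift-cong {x} {y} }
              ; homo = lift-+
              }
            ; ε-homo = X.≈ᴹ-trans (lift-const 0ᴹ) f.0ᴹ-homo
            }
          ; ⁻¹-homo = lift-neg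
          }
        ; *ₗ-homo = lift-*
        ; *ᵣ-homo = λ a x → X.≈ᴹ-trans (lift-* a x) (X.*ₗ-*ᵣ-coincident a (lift x))
        }
      }

    -- Stated for an admissible bound instead of the norm: for continuity, a norm below δ already
    -- provides an admissible r below δ.
    lift-bounded : ∀ x {r} → EventualBound x r → NX.‖ lift x ‖ ≤ c ℝ.* r
    lift-bounded x {r} (0≤r , bound) = ℝ.≤max-small⇒≤ (ℝ.*-nonneg (proj₁ 0<c) 0≤r) λ ε 0<ε →
      let δ , 0<δ , cδ<ε = ℝ.small-multiple c 0<ε
          M , bnd = bound δ 0<δ
          N , close = lift-limit x ε 0<ε
          n = M ⊔ℕ N
      in XP.‖x‖≤ {lift x} {f (proj₁ x n)}
           (begin
             NX.‖ f (proj₁ x n) ‖   ≤⟨ f-bounded _ ⟩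
             c ℝ.* ‖ proj₁ x n ‖    ≤⟨ ℝ.*-monoʳ-≤ (proj₁ 0<c) (bnd n (ℕ.m≤m⊔n M N)) ⟩
             c ℝ.* max r δ          ≤⟨ ℝ.*-max-≤ (ℝ.x≤x⊔y _ _) (ℝ.≤-trans (proj₁ cδ<ε) (ℝ.x≤y⊔x _ _)) ⟩
             max (c ℝ.* r) ε        ∎)
           (ℝ.≤-trans (XP.dist-sym-≤ _ _) (ℝ.≤-trans (proj₁ (close n (ℕ.m≤n⊔m M N))) (ℝ.x≤y⊔x _ _)))

    lift-continuous : IsContinuous norm NX lift
    lift-continuous x ε 0<ε =
      let δ , 0<δ , cδ<ε = ℝ.small-multiple c 0<ε
      in δ , 0<δ , λ y xy<δ →
        let r , bound , r<δ = ℝ.inf-approx (Limit.norm-isInf (x +ᶜ (-ᶜ y))) xy<δ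
        in begin-strict
          NX.‖ lift x X.− lift y ‖        ≈⟨ NX.‖‖-cong (X.+ᴹ-congˡ (lift-neg y)) ⟨
          NX.‖ lift x X.+ᴹ lift (-ᶜ y) ‖  ≈⟨ NX.‖‖-cong (lift-+ x (-ᶜ y)) ⟨
          NX.‖ lift (x +ᶜ (-ᶜ y)) ‖       ≤⟨ lift-bounded (x +ᶜ (-ᶜ y)) bound ⟩
          c ℝ.* r                         ≤⟨ ℝ.*-monoʳ-≤ (proj₁ 0<c) (proj₁ r<δ) ⟩
          c ℝ.* δ                         <⟨ cδ<ε ⟩
          ε                               ∎

-- Finite combinations of translates of v and the gauge of the lattice

module Combinations {ℓ : Level} (em : ExcludedMiddle ℓ) {ℝ : RealNumbers ℓ} {K : ValuedField ℝ ℓ}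
                    {G : Group ℓ ℓ} {W : VectorSpace K} (ρ : Representation {K = K} G W)
                    (v : Module.Carrierᴹ W) where
  private
    module ℝ = RealProperties em ℝ
    module K = ValuedField K
    module G = Group G
  open ℝ using (0#; 1#; _<_; _≤_; max)
  open Valued em K
  open InfimumNorms em K
  open VectorSpaceProperties {K = K} W
  open Representation ρ
  open Membership G.setoid using (_∈_; _∉_)
  open Subset G.setoid using (_⊆_)
  open UniqueIn G.setoid using (Unique)
  private
    module Act (g : G.Carrier) = IsModuleHomomorphism (·-linear g)
    module ≤-R = ℝ.≤-Reasoning
    module ≈-R = SetoidReasoning ≈ᴹ-setoid

  -- An element of the group ring as a list in which group elements may repeat. Sums, multiples and
  -- translates are then list operations, and equality in G matters only when coefficients are read
  -- off.
  Combination : Set ℓ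
  Combination = List (K.Carrier × G.Carrier)

  eval : Combination → Carrierᴹ
  eval = foldr (λ (a , g) s → (a *ₗ (g · v)) +ᴹ s) 0ᴹ

  BoundedBy : ℝ.Carrier → Combination → Set ℓ
  BoundedBy t = All (λ (a , _) → K.abs a ≤ t)

  weaken : ∀ {s t xs} → s ≤ t → BoundedBy s xs → BoundedBy t xs
  weaken s≤t = All.map (λ a≤s → ℝ.≤-trans a≤s s≤t)

  bound : ∀ xs → ∃[ t ] (0# ≤ t × BoundedBy t xs)
  bound []             = 0# , ℝ.≤-refl , []
  bound ((a , g) ∷ xs) =
    let t , 0≤t , bnd = bound xs
    in max (K.abs a) t , ℝ.≤-trans 0≤t (ℝ.x≤y⊔x _ _) , ℝ.x≤x⊔y _ _ ∷ weaken {xs = xs} (ℝ.x≤y⊔x _ _) bnd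

  eval-++ : ∀ xs ys → eval (xs ++ ys) ≈ᴹ eval xs +ᴹ eval ys
  eval-++ []             ys = ≈ᴹ-sym (+ᴹ-identityˡ _)
  eval-++ ((a , g) ∷ xs) ys = ≈ᴹ-trans (+ᴹ-congˡ (eval-++ xs ys)) (≈ᴹ-sym (+ᴹ-assoc _ _ _))

  scaleBy : K.Carrier → Combination → Combination
  scaleBy a = map (λ (b , g) → a K.* b , g)

  eval-scaleBy : ∀ a xs → eval (scaleBy a xs) ≈ᴹ a *ₗ eval xs
  eval-scaleBy a []             = ≈ᴹ-sym (*ₗ-zeroʳ a)
  eval-scaleBy a ((b , g) ∷ xs) =
    ≈ᴹ-trans (+ᴹ-cong (*ₗ-assoc a b _) (eval-scaleBy a xs)) (≈ᴹ-sym (*ₗ-distribˡ a _ _))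

  bounded-scaleBy : ∀ a {t xs} → BoundedBy t xs → BoundedBy (K.abs a ℝ.* t) (scaleBy a xs)
  bounded-scaleBy a []                       = []
  bounded-scaleBy a (_∷_ {b , _} b≤t bnd) =
    ℝ.≤-trans (ℝ.≤-reflexive (K.abs-* a b)) (ℝ.*-monoʳ-≤ (K.abs-nonneg a) b≤t) ∷ bounded-scaleBy a bnd

  translate : G.Carrier → Combination → Combination
  translate h = map (λ (b , g) → b , h G.∙ g)

  eval-translate : ∀ h xs → eval (translate h xs) ≈ᴹ h · eval xs
  eval-translate h []             = ≈ᴹ-sym (Act.0ᴹ-homo h)
  eval-translate h ((b , g) ∷ xs) = begin
    b *ₗ ((h G.∙ g) · v) +ᴹ eval (translate h xs)  ≈⟨ +ᴹ-cong (*ₗ-congˡ (·-assoc h g v)) (eval-translate h xs) ⟩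
    b *ₗ (h · (g · v)) +ᴹ h · eval xs              ≈⟨ +ᴹ-congʳ (Act.*ₗ-homo h b _) ⟨
    h · (b *ₗ (g · v)) +ᴹ h · eval xs              ≈⟨ Act.+ᴹ-homo h _ _ ⟨
    h · (b *ₗ (g · v) +ᴹ eval xs)                  ∎
    where open ≈-R

  bounded-translate : ∀ h {t xs} → BoundedBy t xs → BoundedBy t (translate h xs)
  bounded-translate h []          = []
  bounded-translate h (a≤t ∷ bnd) = a≤t ∷ bounded-translate h bnd

  eval-singleton : eval ((K.1# , G.ε) ∷ []) ≈ᴹ v
  eval-singleton = ≈ᴹ-trans (+ᴹ-identityʳ _) (≈ᴹ-trans (*ₗ-identityˡ _) (·-identity v))

  singleton-bounded : BoundedBy 1# ((K.1# , G.ε) ∷ [])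
  singleton-bounded = ℝ.≤-reflexive abs-1 ∷ []

  eval-generated : ∀ xs → Generated ρ v (eval xs)
  eval-generated []             = Generated.zero
  eval-generated ((a , g) ∷ xs) =
    Generated.add (Generated.scale a (Generated.act g Generated.generator)) (eval-generated xs)

  generated⇒eval : ∀ {w} → Generated ρ v w → ∃[ xs ] (w ≈ᴹ eval xs)
  generated⇒eval Generated.generator         = (K.1# , G.ε) ∷ [] , ≈ᴹ-sym eval-singleton
  generated⇒eval Generated.zero              = [] , ≈ᴹ-refl
  generated⇒eval (Generated.add p q)         =
    let xs , x≈ = generated⇒eval p
        ys , y≈ = generated⇒eval q
    in xs ++ ys , ≈ᴹ-trans (+ᴹ-cong x≈ y≈) (≈ᴹ-sym (eval-++ xs ys))
  generated⇒eval (Generated.scale a p)       =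
    let xs , x≈ = generated⇒eval p
    in scaleBy a xs , ≈ᴹ-trans (*ₗ-congˡ x≈) (≈ᴹ-sym (eval-scaleBy a xs))
  generated⇒eval (Generated.act g p)         =
    let xs , x≈ = generated⇒eval p
    in translate g xs , ≈ᴹ-trans (·-cong G.refl x≈) (≈ᴹ-sym (eval-translate g xs))
  generated⇒eval (Generated.respects x≈y p)  =
    let xs , x≈ = generated⇒eval p in xs , ≈ᴹ-trans (≈ᴹ-sym x≈y) x≈

  -- A real bound t need not be the absolute value of a scalar, but the largest coefficient of a
  -- finite list is one. The empty list takes the scalar 0.
  attained-bound : ∀ {t} → 0# ≤ t → ∀ xs → BoundedBy t xs →
                   ∃[ a ] (K.abs a ≤ t × BoundedBy (K.abs a) xs)
  attained-bound 0≤t []             []          = K.0# , ℝ.≤-trans (ℝ.≤-reflexive K.abs-0) 0≤t , []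
  attained-bound 0≤t ((b , g) ∷ xs) (b≤t ∷ bnd) = choose (ℝ.total (K.abs a) (K.abs b))
    where
    rec = attained-bound 0≤t xs bnd
    a = proj₁ rec
    choose : K.abs a ≤ K.abs b ⊎ K.abs b ≤ K.abs a →
             ∃[ c ] (K.abs c ≤ _ × BoundedBy (K.abs c) ((b , g) ∷ xs))
    choose (inj₁ a≤b) = b , b≤t , ℝ.≤-refl ∷ weaken {xs = xs} a≤b (proj₂ (proj₂ rec))
    choose (inj₂ b≤a) = a , proj₁ (proj₂ rec) , b≤a ∷ proj₂ (proj₂ rec)

  divideBy : ∀ a xs → BoundedBy (K.abs a) xs → ∃[ ys ] (BoundedBy 1# ys × eval xs ≈ᴹ a *ₗ eval ys)
  divideBy a []             []          = [] , [] , ≈ᴹ-sym (*ₗ-zeroʳ a)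
  divideBy a ((b , g) ∷ xs) (b≤a ∷ bnd) =
    let ys , bnd′ , eq = divideBy a xs bnd
        c , c≤1 , b≈ac = divide a b b≤a
    in (c , g) ∷ ys , c≤1 ∷ bnd′ ,
       ≈ᴹ-trans (+ᴹ-cong (≈ᴹ-trans (*ₗ-congʳ b≈ac) (*ₗ-assoc a c _)) eq) (≈ᴹ-sym (*ₗ-distribˡ a _ _))

  ScaledLattice : Carrierᴹ → ℝ.Carrier → Set ℓ
  ScaledLattice w r = ∃[ a ] (r ℝ.≈ K.abs a × ∃[ l ] (Lattice ρ v l × w ≈ᴹ a *ₗ l))

  -- With the converse below, this shows that the infimum of the |a| with w in a L_v is also the
  -- infimum of the coefficient bounds of combinations equal to w.
  bounded⇒scaledLattice : ∀ {t w} → 0# ≤ t → ∀ xs → BoundedBy t xs → w ≈ᴹ eval xs →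
                          ∃[ r ] (r ≤ t × ScaledLattice w r)
  bounded⇒scaledLattice 0≤t xs bnd w≈ =
    let a , a≤t , bnd′ = attained-bound 0≤t xs bnd
        ys , ys≤1 , eq = divideBy a xs bnd′
    in K.abs a , a≤t , a , ℝ.refl , eval ys , (ys , ys≤1 , ≈ᴹ-refl) , ≈ᴹ-trans w≈ eq

  scaledLattice⇒bounded : ∀ {w r} → ScaledLattice w r → ∃[ xs ] (BoundedBy r xs × w ≈ᴹ eval xs)
  scaledLattice⇒bounded (a , r≈ , l , (xs , xs≤1 , l≈) , w≈) =
    scaleBy a xs ,
    weaken {xs = scaleBy a xs} (ℝ.≤-reflexive (ℝ.trans (ℝ.*-identityʳ _) (ℝ.sym r≈))) (bounded-scaleBy a xs≤1) ,
    ≈ᴹ-trans w≈ (≈ᴹ-trans (*ₗ-congˡ l≈) (≈ᴹ-sym (eval-scaleBy a xs)))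

  module _ (N : Norm {K = K} W) (invariant : IsInvariant ρ N) where
    open Norm N
    open NormProperties N

    -- All translates of v have the norm of v, and the ultrametric inequality makes the number of
    -- terms irrelevant.
    ‖eval‖≤ : ∀ {t} → 0# ≤ t → ∀ xs → BoundedBy t xs → ‖ eval xs ‖ ≤ ‖ v ‖ ℝ.* t
    ‖eval‖≤ {t} 0≤t []             []          = ℝ.≤-trans (ℝ.≤-reflexive ‖0‖≈0) (ℝ.*-nonneg (nonneg v) 0≤t)
    ‖eval‖≤ {t} 0≤t ((a , g) ∷ xs) (a≤t ∷ bnd) = ‖+‖≤ (begin
      ‖ a *ₗ (g · v) ‖           ≈⟨ homogeneous a (g · v) ⟩
      K.abs a ℝ.* ‖ g · v ‖      ≈⟨ ℝ.*-congˡ (invariant g v) ⟩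
      K.abs a ℝ.* ‖ v ‖          ≈⟨ ℝ.*-comm _ _ ⟩
      ‖ v ‖ ℝ.* K.abs a          ≤⟨ ℝ.*-monoʳ-≤ (nonneg v) a≤t ⟩
      ‖ v ‖ ℝ.* t                ∎) (‖eval‖≤ 0≤t xs bnd)
      where open ≤-R

  -- The missing inequality is the contraction by the inverse of g, applied at `g · x`.
  contracting⇒invariant : ∀ N → (∀ g x → Norm.‖_‖ N (g · x) ≤ Norm.‖_‖ N x) → IsInvariant ρ N
  contracting⇒invariant N contracting g x = ℝ.antisym (contracting g x) (begin
    ‖ x ‖                       ≈⟨ ‖‖-cong g⁻¹gx≈x ⟨
    ‖ (g G.⁻¹) · (g · x) ‖      ≤⟨ contracting (g G.⁻¹) (g · x) ⟩
    ‖ g · x ‖                   ∎)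
    where
    open Norm N
    open ≤-R
    g⁻¹gx≈x : (g G.⁻¹) · (g · x) ≈ᴹ x
    g⁻¹gx≈x = ≈ᴹ-trans (≈ᴹ-sym (·-assoc (g G.⁻¹) g x))
      (≈ᴹ-trans (·-cong (G.inverseˡ g) ≈ᴹ-refl) (·-identity x))

  V : VectorSpace K
  V = generatedSubspace ρ v

  inclusion-linear : IsLinear {K = K} V W proj₁
  inclusion-linear = record
    { isBimoduleHomomorphism = record
      { +ᴹ-isGroupHomomorphism = record
        { isMonoidHomomorphism = record
          { isMagmaHomomorphism = record
            { isRelHomomorphism = record { cong = λ x≈y → x≈y }
            ; homo = λ _ _ → ≈ᴹ-refl
            }
          ; ε-homo = ≈ᴹ-refl
          }
        ; ⁻¹-homo = λ _ → ≈ᴹ-refl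
        }
      ; *ₗ-homo = λ _ _ → ≈ᴹ-refl
      ; *ᵣ-homo = λ a (x , _) → *ₗ-*ᵣ-coincident a x
      }
    }

  evalⱽ : Combination → Module.Carrierᴹ V
  evalⱽ xs = eval xs , eval-generated xs

  module _ (N : Norm {K = K} W) (invariant : IsInvariant ρ N) where
    open Norm N
    open NormProperties N

    -- The gauge of L_v in terms of real coefficient bounds, for which addition is concatenation of
    -- lists. The condition `0# ≤ t` is there for the empty list, which satisfies every coefficient
    -- bound.
    IsBoundedCombination : Module.Carrierᴹ V → ℝ.Carrier → Set ℓ
    IsBoundedCombination (w , _) t = 0# ≤ t × ∃[ xs ] (BoundedBy t xs × w ≈ᴹ eval xs)

    isBoundedCombination-isGauge : IsGauge V IsBoundedCombination
    isBoundedCombination-isGauge = record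
      { resp      = λ x≈y (0≤t , xs , bnd , eq) → 0≤t , xs , bnd , ≈ᴹ-trans (≈ᴹ-sym x≈y) eq
      ; nonneg    = proj₁
      ; inhabited = λ (w , p) →
          let xs , eq = generated⇒eval p
              t , 0≤t , bnd = bound xs
          in t , 0≤t , xs , bnd , eq
      ; scaled    = λ a (0≤t , xs , bnd , eq) → ℝ.*-nonneg (K.abs-nonneg a) 0≤t , scaleBy a xs ,
          bounded-scaleBy a bnd , ≈ᴹ-trans (*ₗ-congˡ eq) (≈ᴹ-sym (eval-scaleBy a xs))
      ; summed    = λ (0≤r , xs , bnd , eq) (_ , ys , bnd′ , eq′) → ℝ.≤-trans 0≤r (ℝ.x≤x⊔y _ _) , xs ++ ys ,
          All.++⁺ (weaken {xs = xs} (ℝ.x≤x⊔y _ _) bnd) (weaken {xs = ys} (ℝ.x≤y⊔x _ _) bnd′) ,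
          ≈ᴹ-trans (+ᴹ-cong eq eq′) (≈ᴹ-sym (eval-++ xs ys))
      -- The given invariant norm makes the gauge definite: a coefficient bound t for w gives ‖w‖ ≤
      -- ‖v‖ t.
      ; definite  = λ {(w , _)} small → definite w (ℝ.antisym (ℝ.≤-small⇒≤0 λ ε 0<ε →
          let δ , 0<δ , vδ<ε = ℝ.small-multiple ‖ v ‖ 0<ε
              t , (0≤t , xs , bnd , eq) , t<δ = small δ 0<δ
          in begin
            ‖ w ‖           ≈⟨ ‖‖-cong eq ⟩
            ‖ eval xs ‖     ≤⟨ ‖eval‖≤ N invariant 0≤t xs bnd ⟩
            ‖ v ‖ ℝ.* t     ≤⟨ ℝ.*-monoʳ-≤ (nonneg v) (proj₁ t<δ) ⟩
            ‖ v ‖ ℝ.* δ     ≤⟨ proj₁ vδ<ε ⟩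
            ε               ∎) (nonneg w))
      }
      where open ≤-R

    gauge : Norm {K = K} V
    gauge = InfimumNorm.norm isBoundedCombination-isGauge

    gauge-isGaugeNorm : IsGaugeNorm ρ v gauge
    gauge-isGaugeNorm (w , p) = lower , greatest
      where
      lower : ℝ.IsLowerBound (ScaledLattice w) (Norm.‖_‖ gauge (w , p))
      lower r (a , r≈ , rest) =
        let xs , bnd , eq = scaledLattice⇒bounded (a , r≈ , rest)
        in InfimumNorm.norm-≤ isBoundedCombination-isGauge {w , p}
             (ℝ.≤-trans (K.abs-nonneg a) (ℝ.≤-reflexive (ℝ.sym r≈)) , xs , bnd , eq)
      greatest : ∀ b → ℝ.IsLowerBound (ScaledLattice w) b → b ≤ Norm.‖_‖ gauge (w , p)
      greatest b lb = InfimumNorm.≤-norm isBoundedCombination-isGauge {w , p} λ (0≤t , xs , bnd , eq) →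
        let r , r≤t , Qr = bounded⇒scaledLattice 0≤t xs bnd eq in ℝ.≤-trans (lb r Qr) r≤t

  vⱽ : Module.Carrierᴹ V
  vⱽ = v , Generated.generator

  module _ (gaugeNorm : Norm {K = K} V) (isGaugeNorm : IsGaugeNorm ρ v gaugeNorm) where

    gaugeNorm-≤ : ∀ {t w} → 0# ≤ t → ∀ xs → BoundedBy t xs → proj₁ w ≈ᴹ eval xs → Norm.‖_‖ gaugeNorm w ≤ t
    gaugeNorm-≤ {w = w} 0≤t xs bnd eq =
      let r , r≤t , Qr = bounded⇒scaledLattice 0≤t xs bnd eq
      in ℝ.≤-trans (proj₁ (isGaugeNorm w) r Qr) r≤t

    -- Maximality of the gauge among invariant norms, with the factor ‖v‖ kept because it is also
    -- applied before v is known to have norm 1.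
    ‖‖≤gaugeNorm : ∀ (N : Norm {K = K} W) → IsInvariant ρ N → 0# < Norm.‖_‖ N v →
                   ∀ w → Norm.‖_‖ N (proj₁ w) ≤ Norm.‖_‖ N v ℝ.* Norm.‖_‖ gaugeNorm w
    ‖‖≤gaugeNorm N invariant 0<v w = ℝ.≤-scaled-inf (isGaugeNorm w) 0<v λ r Qr →
      let xs , bnd , eq = scaledLattice⇒bounded Qr
          a , r≈ , _ = Qr
      in ℝ.≤-trans (ℝ.≤-reflexive (Norm.‖‖-cong N eq))
           (‖eval‖≤ N invariant (ℝ.≤-trans (K.abs-nonneg a) (ℝ.≤-reflexive (ℝ.sym r≈))) xs bnd)

    ‖v‖-gaugeNorm-≤1 : Norm.‖_‖ gaugeNorm vⱽ ≤ 1#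
    ‖v‖-gaugeNorm-≤1 = gaugeNorm-≤ {w = vⱽ} ℝ.0≤1 _ singleton-bounded (≈ᴹ-sym eval-singleton)

  -- A Kronecker delta times a. The decision is an argument so that the lemmas below can split on
  -- it, although it is later supplied by excluded middle.
  pick : {P : Set ℓ} → Dec P → K.Carrier → K.Carrier
  pick (yes _) a = a
  pick (no  _) a = K.0#

  pick-cong : {P Q : Set ℓ} (p : Dec P) (q : Dec Q) → (P → Q) → (Q → P) → ∀ a → pick p a K.≈ pick q a
  pick-cong (yes _) (yes _) _ _ a = K.refl
  pick-cong (no  _) (no  _) _ _ a = K.refl
  pick-cong (yes p) (no ¬q) f _ a = contradiction (f p) ¬q
  pick-cong (no ¬p) (yes q) _ g a = contradiction (g q) ¬p

  pick-yes : {P : Set ℓ} (d : Dec P) → P → ∀ a → pick d a K.≈ a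
  pick-yes (yes _) _ a = K.refl
  pick-yes (no ¬p) p a = contradiction p ¬p

  pick-no : {P : Set ℓ} (d : Dec P) → ¬ P → ∀ a → pick d a K.≈ K.0#
  pick-no (yes p) ¬p a = contradiction p ¬p
  pick-no (no _)  _  a = K.refl

  pick-bounded : {P : Set ℓ} (d : Dec P) → ∀ {a t} → 0# ≤ t → K.abs a ≤ t → K.abs (pick d a) ≤ t
  pick-bounded (yes _) 0≤t a≤t = a≤t
  pick-bounded (no  _) 0≤t a≤t = ℝ.≤-trans (ℝ.≤-reflexive K.abs-0) 0≤t

  -- Turns a list with repetitions into a function on G, the form in which summable families and
  -- their sums are stated.
  coefficient : Combination → G.Carrier → K.Carrier
  coefficient xs g = foldr (λ (a , h) s → pick (em {P = h G.≈ g}) a K.+ s) K.0# xs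

  coefficient-cong : ∀ xs → Congruent G._≈_ K._≈_ (coefficient xs)
  coefficient-cong []             g≈g′ = K.refl
  coefficient-cong ((a , h) ∷ xs) g≈g′ = K.+-cong
    (pick-cong em em (λ h≈g → G.trans h≈g g≈g′) (λ h≈g′ → G.trans h≈g′ (G.sym g≈g′)) a)
    (coefficient-cong xs g≈g′)

  coefficient-bounded : ∀ {t} → 0# ≤ t → ∀ xs → BoundedBy t xs → ∀ g → K.abs (coefficient xs g) ≤ t
  coefficient-bounded 0≤t []             []          g = ℝ.≤-trans (ℝ.≤-reflexive K.abs-0) 0≤t
  coefficient-bounded 0≤t ((a , h) ∷ xs) (a≤t ∷ bnd) g =
    NormProperties.‖+‖≤ absNorm (pick-bounded em 0≤t a≤t) (coefficient-bounded 0≤t xs bnd g)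

  coefficient-++ : ∀ xs ys g → coefficient (xs ++ ys) g K.≈ coefficient xs g K.+ coefficient ys g
  coefficient-++ []             ys g = K.sym (K.+-identityˡ _)
  coefficient-++ ((a , h) ∷ xs) ys g = K.trans (K.+-congˡ (coefficient-++ xs ys g)) (K.sym (K.+-assoc _ _ _))

  support : Combination → List G.Carrier
  support = map proj₂

  coefficient-∉ : ∀ xs {g} → g ∉ support xs → coefficient xs g K.≈ K.0#
  coefficient-∉ []             g∉ = K.refl
  coefficient-∉ ((a , h) ∷ xs) g∉ = K.trans
    (K.+-cong (pick-no em (λ h≈g → g∉ (here (G.sym h≈g))) a) (coefficient-∉ xs (g∉ ∘ there)))
    (K.+-identityˡ K.0#)

  sumOver : List G.Carrier → (G.Carrier → Carrierᴹ) → Carrierᴹ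
  sumOver gs f = foldr (λ g s → f g +ᴹ s) 0ᴹ gs

  sumOver-cong : ∀ gs {f f′} → (∀ g → f g ≈ᴹ f′ g) → sumOver gs f ≈ᴹ sumOver gs f′
  sumOver-cong []       f≈f′ = ≈ᴹ-refl
  sumOver-cong (g ∷ gs) f≈f′ = +ᴹ-cong (f≈f′ g) (sumOver-cong gs f≈f′)

  sumOver-0 : ∀ gs {f} → All (λ g → f g ≈ᴹ 0ᴹ) gs → sumOver gs f ≈ᴹ 0ᴹ
  sumOver-0 []       []         = ≈ᴹ-refl
  sumOver-0 (g ∷ gs) (f≈0 ∷ fs) = ≈ᴹ-trans (+ᴹ-cong f≈0 (sumOver-0 gs fs)) (+ᴹ-identityˡ 0ᴹ)

  sumOver-+ : ∀ gs f f′ → sumOver gs (λ g → f g +ᴹ f′ g) ≈ᴹ sumOver gs f +ᴹ sumOver gs f′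
  sumOver-+ []       f f′ = ≈ᴹ-sym (+ᴹ-identityˡ 0ᴹ)
  sumOver-+ (g ∷ gs) f f′ = ≈ᴹ-trans (+ᴹ-congˡ (sumOver-+ gs f f′)) (+ᴹ-interchange _ _ _ _)

  -- Exactly one entry of a duplicate-free list containing h equals h, and all other terms vanish.
  sumOver-pick : ∀ a h gs → Unique gs → h ∈ gs →
                 sumOver gs (λ g → pick (em {P = h G.≈ g}) a *ₗ (g · v)) ≈ᴹ a *ₗ (h · v)
  sumOver-pick a h (g ∷ gs) (g∉gs ∷ _) (here h≈g) = ≈ᴹ-trans
    (+ᴹ-cong (*ₗ-cong (pick-yes em h≈g a) (·-cong (G.sym h≈g) ≈ᴹ-refl))
             (sumOver-0 gs (All.map (λ g≉g′ → ≈ᴹ-trans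
               (*ₗ-congʳ (pick-no em (λ h≈g′ → g≉g′ (G.trans (G.sym h≈g) h≈g′)) a)) (*ₗ-zeroˡ _)) g∉gs)))
    (+ᴹ-identityʳ _)
  sumOver-pick a h (g ∷ gs) (g∉gs ∷ unique) (there h∈gs) = ≈ᴹ-trans
    (+ᴹ-cong (≈ᴹ-trans (*ₗ-congʳ (pick-no em h≉g a)) (*ₗ-zeroˡ _)) (sumOver-pick a h gs unique h∈gs))
    (+ᴹ-identityˡ _)
    where
    h≉g : ¬ h G.≈ g
    h≉g h≈g = Membershipₚ.All[≉]⇒∉ G.setoid g∉gs (Membershipₚ.∈-resp-≈ G.setoid h≈g h∈gs)

  -- The value is the same for every duplicate-free list that contains the support, which is what
  -- convergence along the finite subsets of G requires.
  sumOver-coefficient : ∀ xs gs → Unique gs → support xs ⊆ gs →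
                        sumOver gs (λ g → coefficient xs g *ₗ (g · v)) ≈ᴹ eval xs
  sumOver-coefficient []             gs unique sub = sumOver-0 gs (All.universal (λ g → *ₗ-zeroˡ (g · v)) gs)
  sumOver-coefficient ((a , h) ∷ xs) gs unique sub = begin
    sumOver gs (λ g → coefficient ((a , h) ∷ xs) g *ₗ (g · v))
      ≈⟨ sumOver-cong gs (λ g → *ₗ-distribʳ (g · v) _ _) ⟩
    sumOver gs (λ g → pick (em {P = h G.≈ g}) a *ₗ (g · v) +ᴹ coefficient xs g *ₗ (g · v))
      ≈⟨ sumOver-+ gs _ _ ⟩
    sumOver gs (λ g → pick (em {P = h G.≈ g}) a *ₗ (g · v)) +ᴹ sumOver gs (λ g → coefficient xs g *ₗ (g · v))
      ≈⟨ +ᴹ-cong (sumOver-pick a h gs unique (sub (here G.refl)))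
                 (sumOver-coefficient xs gs unique (sub ∘ there)) ⟩
    a *ₗ (h · v) +ᴹ eval xs ∎
    where open ≈-R

  module _ (N : Norm {K = K} W) where
    open Norm N
    open NormProperties N

    -- The error does not grow with the length of the list, so one termwise estimate controls all
    -- finite partial sums at once.
    sumOver-dist-≤ : ∀ {t} → 0# ≤ t → ∀ gs {f f′} → (∀ g → dist (f g) (f′ g) ≤ t) →
                     dist (sumOver gs f) (sumOver gs f′) ≤ t
    sumOver-dist-≤ 0≤t []       close = ℝ.≤-trans (ℝ.≤-reflexive (‖≈0‖≈0 (-ᴹ‿inverseʳ 0ᴹ))) 0≤t
    sumOver-dist-≤ 0≤t (g ∷ gs) close = ℝ.≤-trans
      (ℝ.≤-reflexive (‖‖-cong (+ᴹ-−-interchange _ _ _ _)))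
      (‖+‖≤ (close g) (sumOver-dist-≤ 0≤t gs close))

-- The equivalence for a fixed Banach representation and non-zero vector

module CyclicVectors {ℓ : Level} (em : ExcludedMiddle ℓ) {ℝ : RealNumbers ℓ} {K : ValuedField ℝ ℓ}
                      (K-complete : Metric.IsComplete ℝ (ValuedField.dist K))
                      {G : Group ℓ ℓ} {W : VectorSpace K} (ρ : Representation {K = K} G W)
                      (N : Norm {K = K} W) (invariant : IsInvariant ρ N) (N-complete : Norm.IsComplete N)
                      (v : Module.Carrierᴹ W) (v≉0 : ¬ Module._≈ᴹ_ W v (Module.0ᴹ W)) where
  private
    module ℝ = RealProperties em ℝ
    module K = ValuedField K
    module G = Group G
  open ℝ using (0#; 1#; _<_; _≤_; max; ½; 2#; halving)
  open ℝ.≤-Reasoning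
  open Valued em K
  open InfimumNorms em K
  open VectorSpaceProperties {K = K} W
  open Representation ρ
  open Combinations em ρ v
  open Membership G.setoid using (_∈_)
  open Norm N
  open NormProperties N
  private
    module AbsP = NormProperties absNorm
    module V = VectorSpaceProperties {K = K} V

  -- A scalar of absolute value r need not exist, so r bounds the coefficients
  -- instead of scaling the lattice.
  Approximable : Set ℓ
  Approximable = ∀ {w r} → ‖ w ‖ < r → ∃[ xs ] (BoundedBy r xs × dist w (eval xs) < ½ ℝ.* r)

  -- Local maximality implies approximability

  module ThickenedGauge (normalized : IsNormalizedAt v N) where

    -- The gauge of the lattice L_v thickened by the ball of radius 1/2. L_v alone spans only V; the
    -- thickening makes the gauge finite on all of B and dominated by ‖·‖. Since 2 ≥ 1, the new norm
    -- stays above ‖·‖; since 2 > 1, the approximation error shrinks at each iteration.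
    IsThickBound : Carrierᴹ → ℝ.Carrier → Set ℓ
    IsThickBound w t = ∃[ xs ] (BoundedBy t xs × 2# ℝ.* dist w (eval xs) ≤ t)

    thickBound-nonneg : ∀ {w t} → IsThickBound w t → 0# ≤ t
    thickBound-nonneg (_ , _ , close) = ℝ.≤-trans (ℝ.*-nonneg (proj₁ ℝ.0<2) (nonneg _)) close

    thickBound-[] : ∀ w → IsThickBound w (2# ℝ.* ‖ w ‖)
    thickBound-[] w = [] , [] , ℝ.≤-reflexive (ℝ.*-congˡ (‖‖-cong (x−0≈x w)))

    -- Both the combination and its distance to w are at most t. This yields definiteness of the
    -- thickened gauge and the lower half of its normalization.
    ‖‖≤thickBound : ∀ {w t} → IsThickBound w t → ‖ w ‖ ≤ t
    ‖‖≤thickBound {w} {t} b@(xs , bnd , close) = ‖x‖≤ {w} {eval xs}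
      (begin
        ‖ eval xs ‖     ≤⟨ ‖eval‖≤ N invariant (thickBound-nonneg b) xs bnd ⟩
        ‖ v ‖ ℝ.* t     ≈⟨ ℝ.*-congʳ normalized ⟩
        1# ℝ.* t        ≈⟨ ℝ.*-identityˡ t ⟩
        t               ∎)
      (ℝ.≤-trans (ℝ.x≤2x (nonneg _)) close)

    isThickBound-isGauge : IsGauge W IsThickBound
    isThickBound-isGauge = record
      { resp      = λ x≈y (xs , bnd , close) → xs , bnd ,
          ℝ.≤-trans (ℝ.≤-reflexive (ℝ.*-congˡ (‖‖-cong (−-cong (≈ᴹ-sym x≈y) ≈ᴹ-refl)))) close
      ; nonneg    = thickBound-nonneg
      ; inhabited = λ w → _ , thickBound-[] w
      ; scaled    = λ a {w} {t} (xs , bnd , close) → scaleBy a xs , bounded-scaleBy a bnd , (begin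
          2# ℝ.* ‖ a *ₗ w − eval (scaleBy a xs) ‖   ≈⟨ ℝ.*-congˡ (‖‖-cong (−-cong ≈ᴹ-refl (eval-scaleBy a xs))) ⟩
          2# ℝ.* ‖ a *ₗ w − a *ₗ eval xs ‖          ≈⟨ ℝ.*-congˡ (‖‖-cong (*ₗ-−-distribˡ a w (eval xs))) ⟨
          2# ℝ.* ‖ a *ₗ (w − eval xs) ‖             ≈⟨ ℝ.*-congˡ (homogeneous a _) ⟩
          2# ℝ.* (K.abs a ℝ.* dist w (eval xs))     ≈⟨ ℝ.*-assoc _ _ _ ⟨
          2# ℝ.* K.abs a ℝ.* dist w (eval xs)       ≈⟨ ℝ.*-congʳ (ℝ.*-comm _ _) ⟩
          K.abs a ℝ.* 2# ℝ.* dist w (eval xs)       ≈⟨ ℝ.*-assoc _ _ _ ⟩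
          K.abs a ℝ.* (2# ℝ.* dist w (eval xs))     ≤⟨ ℝ.*-monoʳ-≤ (K.abs-nonneg a) close ⟩
          K.abs a ℝ.* t                             ∎)
      ; summed    = λ {x} {y} {r} {s} (xs , bnd , close) (ys , bnd′ , close′) → xs ++ ys ,
          All.++⁺ (weaken {xs = xs} (ℝ.x≤x⊔y _ _) bnd) (weaken {xs = ys} (ℝ.x≤y⊔x _ _) bnd′) , (begin
          2# ℝ.* ‖ (x +ᴹ y) − eval (xs ++ ys) ‖
            ≈⟨ ℝ.*-congˡ (‖‖-cong (≈ᴹ-trans (−-cong ≈ᴹ-refl (eval-++ xs ys)) (+ᴹ-−-interchange _ _ _ _))) ⟩
          2# ℝ.* ‖ (x − eval xs) +ᴹ (y − eval ys) ‖
            ≤⟨ ℝ.*-monoʳ-≤ (proj₁ ℝ.0<2) (ultrametric _ _) ⟩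
          2# ℝ.* max (dist x (eval xs)) (dist y (eval ys))
            ≤⟨ ℝ.*-max-≤ (ℝ.≤-trans close (ℝ.x≤x⊔y _ _)) (ℝ.≤-trans close′ (ℝ.x≤y⊔x _ _)) ⟩
          max r s ∎)
      ; definite  = λ {w} small → definite w (ℝ.antisym (ℝ.≤-small⇒≤0 λ ε 0<ε →
          let t , b , t<ε = small ε 0<ε in ℝ.≤-trans (‖‖≤thickBound b) (proj₁ t<ε)) (nonneg w))
      }

    module Thick = InfimumNorm isThickBound-isGauge

    thick-invariant : IsInvariant ρ Thick.norm
    thick-invariant = contracting⇒invariant Thick.norm λ g w →
      Thick.≤-norm λ {t} (xs , bnd , close) → Thick.norm-≤ (translate g xs , bounded-translate g bnd , (begin
        2# ℝ.* ‖ g · w − eval (translate g xs) ‖  ≈⟨ ℝ.*-congˡ (‖‖-cong (translate-dist g w xs)) ⟩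
        2# ℝ.* ‖ g · (w − eval xs) ‖              ≈⟨ ℝ.*-congˡ (invariant g _) ⟩
        2# ℝ.* dist w (eval xs)                   ≤⟨ close ⟩
        t                                         ∎))
      where
      translate-dist : ∀ g w xs → g · w − eval (translate g xs) ≈ᴹ g · (w − eval xs)
      translate-dist g w xs = ≈ᴹ-trans
        (+ᴹ-congˡ (≈ᴹ-trans (-ᴹ‿cong (eval-translate g xs)) (≈ᴹ-sym (Act.-ᴹ-homo (eval xs)))))
        (≈ᴹ-sym (Act.+ᴹ-homo w (-ᴹ eval xs)))
        where module Act = IsModuleHomomorphism (·-linear g)

    thick-normalized : IsNormalizedAt v Thick.norm
    thick-normalized = ℝ.antisym
      (Thick.norm-≤ (_ , singleton-bounded , (begin
        2# ℝ.* ‖ v − eval ((K.1# , G.ε) ∷ []) ‖  ≈⟨ ℝ.*-congˡ (‖≈0‖≈0 (x≈y⇒x-y≈0 (≈ᴹ-sym eval-singleton))) ⟩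
        2# ℝ.* 0#                               ≈⟨ ℝ.zeroʳ 2# ⟩
        0#                                      ≤⟨ ℝ.0≤1 ⟩
        1#                                      ∎)))
      (ℝ.≤-trans (ℝ.≤-reflexive (ℝ.sym normalized)) (Thick.≤-norm ‖‖≤thickBound))

    thick-dominated : IsDominatedBy Thick.norm N
    thick-dominated = 2# , ℝ.0<2 , λ w → Thick.norm-≤ (thickBound-[] w)

    locallyMaximal⇒approximable : IsLocallyMaximalAt ρ v N → Approximable
    locallyMaximal⇒approximable maximal {w} {r} ‖w‖<r =
      let thick≤N = maximal Thick.norm thick-invariant thick-normalized thick-dominated
          t , (xs , bnd , close) , t<r = ℝ.inf-approx (Thick.norm-isInf w) (ℝ.≤-<-trans (thick≤N w) ‖w‖<r)
      -- The strict inequality t < r becomes a distance strictly below r/2, so the remainder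
      -- satisfies the hypothesis of `Approximable` again at half the radius.
      in xs , weaken {xs = xs} (proj₁ t<r) bnd , ℝ.≰⇒> λ ½r≤dist → ℝ.<⇒≱ t<r (begin
           r                         ≈⟨ ℝ.2*½*x≈x r ⟨
           2# ℝ.* (½ ℝ.* r)          ≤⟨ ℝ.*-monoʳ-≤ (proj₁ ℝ.0<2) ½r≤dist ⟩
           2# ℝ.* dist w (eval xs)   ≤⟨ close ⟩
           t                         ∎)

  -- Iterated approximation and strong cyclicity

  module Expansion (approximable : Approximable) {w : Carrierᴹ} {r : ℝ.Carrier} (‖w‖<r : ‖ w ‖ < r) where

    0<r : 0# < r
    0<r = ℝ.≤-<-trans (nonneg w) ‖w‖<r

    PartialExpansion : ℕ → Set ℓ
    PartialExpansion n = ∃[ xs ] (dist w (eval xs) < halving r n)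

    -- `partial` records only the distance to w. The bound on the terms added at each stage is kept
    -- in `next`, because it makes both the coefficients and the images in V̂ converge.
    partial : ∀ n → PartialExpansion n
    next : ∀ n → ∃[ ys ] (BoundedBy (halving r n) ys ×
                          dist (w − eval (proj₁ (partial n))) (eval ys) < halving r (1+ n))

    partial 0ℕ     = [] , ℝ.≤-<-trans (ℝ.≤-reflexive (‖‖-cong (x−0≈x w))) ‖w‖<r
    partial (1+ n) = proj₁ (next n) ++ proj₁ (partial n) , (begin-strict
      ‖ w − eval (proj₁ (next n) ++ proj₁ (partial n)) ‖            ≈⟨ ‖‖-cong (−-cong ≈ᴹ-refl (eval-++ (proj₁ (next n)) _)) ⟩
      ‖ w − (eval (proj₁ (next n)) +ᴹ eval (proj₁ (partial n))) ‖   ≈⟨ ‖‖-cong (−-assoc w _ _) ⟩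
      ‖ (w − eval (proj₁ (partial n))) − eval (proj₁ (next n)) ‖    <⟨ proj₂ (proj₂ (next n)) ⟩
      halving r (1+ n)                                              ∎)

    next n = approximable (proj₂ (partial n))

    sums : ℕ → Combination
    sums n = proj₁ (partial n)

    sums-close : ∀ n → dist w (eval (sums n)) < halving r n
    sums-close n = proj₂ (partial n)

    steps : ℕ → Combination
    steps n = proj₁ (next n)

    steps-bounded : ∀ n → BoundedBy (halving r n) (steps n)
    steps-bounded n = proj₁ (proj₂ (next n))

    0≤halving : ∀ n → 0# ≤ halving r n
    0≤halving n = proj₁ (ℝ.halving-positive 0<r n)

    abstract
      -- Stage n changes the coefficient at g by at most r/2ⁿ. This rate is the same for all g,
      -- which is what summability and the convergence of the sum rely on.
      coefficient-limit : ∀ g → ∃[ c ] (∀ n → K.dist c (coefficient (sums n) g) ≤ halving r n)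
      coefficient-limit g = AbsP.halving-steps-limit 0<r (λ n → coefficient (sums n) g) step K-complete
        where
        step : ∀ n → K.dist (coefficient (sums (1+ n)) g) (coefficient (sums n) g) ≤ halving r n
        step n = ℝ.≤-trans
          (ℝ.≤-reflexive (K.abs-cong (K.trans (K.+-congʳ (coefficient-++ (steps n) (sums n) g))
            (KV.[x+y]−y≈x _ _))))
          (coefficient-bounded (0≤halving n) (steps n) (steps-bounded n) g)
          where
            module KV = VectorSpaceProperties {K = K} TensorUnit.⟨module⟩

    c : G.Carrier → K.Carrier
    c g = proj₁ (coefficient-limit g)

    c-close : ∀ n g → K.dist (c g) (coefficient (sums n) g) ≤ halving r n
    c-close n g = proj₂ (coefficient-limit g) n

    -- The limit is chosen separately for each g, so compatibility with equality in G is recovered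
    -- from the approximating coefficients.
    c-cong : Congruent G._≈_ K._≈_ c
    c-cong {g} {h} g≈h = AbsP.dist-small⇒≈ λ ε 0<ε →
      let n , small = ℝ.halving-small r 0<r ε 0<ε
      in ℝ.≤-trans (AbsP.dist-≤ {c g} {coefficient (sums n) g} {c h} (c-close n g)
           (ℝ.≤-trans (ℝ.≤-reflexive (K.abs-cong (K.+-congʳ (coefficient-cong (sums n) g≈h))))
             (ℝ.≤-trans (AbsP.dist-sym-≤ (coefficient (sums n) h) (c h)) (c-close n h)))) (proj₁ small)

    -- Outside the finite support of the n-th partial combination its coefficients vanish, which
    -- leaves |c g| ≤ r/2ⁿ < ε.
    c-summable : IsSummable ρ c
    c-summable ε 0<ε =
      let n , small = ℝ.halving-small r 0<r ε 0<ε
      in support (sums n) , λ g ε≤∣c∣ → decidable-stable em λ g∉ → ℝ.<⇒≱ small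
           (ℝ.≤-trans ε≤∣c∣ (c-outside n g g∉))
      where
      c-outside : ∀ n g → ¬ g ∈ support (sums n) → K.abs (c g) ≤ halving r n
      c-outside n g g∉ = AbsP.‖x‖≤ {c g} {coefficient (sums n) g}
        (ℝ.≤-trans (ℝ.≤-reflexive (ℝ.trans (K.abs-cong (coefficient-∉ (sums n) g∉)) K.abs-0)) (0≤halving n))
        (c-close n g)

    -- On a finite set containing the support of the n-th partial combination, replacing c by the
    -- n-th coefficients costs at most r/2ⁿ. The sum then becomes the n-th partial sum, which is
    -- within r/2ⁿ of w.
    c-hasSum : IsNormalizedAt v N → HasSum ρ N (λ g → c g *ₗ (g · v)) w
    c-hasSum normalized ε 0<ε =
      let n , small = ℝ.halving-small r 0<r ε 0<ε
      in support (sums n) , λ gs unique sub → ℝ.≤-<-trans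
           (dist-≤ (sumOver-dist-≤ N (0≤halving n) gs (term-close n))
             (dist-≤ (ℝ.≤-trans (ℝ.≤-reflexive (‖≈0‖≈0 (x≈y⇒x-y≈0 (sumOver-coefficient (sums n) gs unique sub))))
                       (0≤halving n))
               (ℝ.≤-trans (dist-sym-≤ _ _) (proj₁ (sums-close n))))) small
      where
      term-close : ∀ n g → dist (c g *ₗ (g · v)) (coefficient (sums n) g *ₗ (g · v)) ≤ halving r n
      term-close n g = begin
        ‖ c g *ₗ (g · v) − coefficient (sums n) g *ₗ (g · v) ‖    ≈⟨ ‖‖-cong (*ₗ-−-distribʳ _ _ _) ⟨
        ‖ (c g K.- coefficient (sums n) g) *ₗ (g · v) ‖           ≈⟨ homogeneous _ _ ⟩
        K.dist (c g) (coefficient (sums n) g) ℝ.* ‖ g · v ‖       ≈⟨ ℝ.*-congˡ (ℝ.trans (invariant g v) normalized) ⟩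
        K.dist (c g) (coefficient (sums n) g) ℝ.* 1#              ≈⟨ ℝ.*-identityʳ _ ⟩
        K.dist (c g) (coefficient (sums n) g)                     ≤⟨ c-close n g ⟩
        halving r n                                               ∎

  approximable⇒stronglyCyclic : IsNormalizedAt v N → Approximable → IsStronglyCyclic ρ N v
  approximable⇒stronglyCyclic normalized approximable = v≉0 , λ w →
    -- Any radius above the norm of w serves here; only the existence of an expansion is claimed.
    let module E = Expansion approximable (ℝ.x<x+1 ‖ w ‖)
    in E.c , E.c-cong , E.c-summable , E.c-hasSum normalized

  -- Uniqueness is symmetric: equivalent norms dominate each other, so the local maximality of each
  -- bounds the other.
  locallyMaximal⇒canonical : IsNormalizedAt v N → IsLocallyMaximalAt ρ v N → EqualsCanonicalNorm ρ N v
  locallyMaximal⇒canonical normalized maximal =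
    (N , (invariant , (self , self) , normalized , maximal) ,
     λ { {N′} (invariant′ , (N′≼N , N≼N′) , normalized′ , maximal′) x →
         ℝ.antisym (maximal′ N invariant normalized N≼N′ x) (maximal N′ invariant′ normalized′ N′≼N x) }) ,
    λ _ → ℝ.refl
    where
    self : IsDominatedBy N N
    self = 1# , ℝ.0<1 , λ x → ℝ.≤-reflexive (ℝ.sym (ℝ.*-identityˡ ‖ x ‖))

  -- Both properties depend only on the values of the norm, so they pass from the canonical norm to
  -- N.
  canonical⇒locallyMaximal : EqualsCanonicalNorm ρ N v → IsNormalizedAt v N × IsLocallyMaximalAt ρ v N
  canonical⇒locallyMaximal ((N₀ , (_ , _ , normalized , maximal) , _) , N≗N₀) =
    ℝ.trans (N≗N₀ v) normalized ,
    λ N′ invariant′ normalized′ (D , 0<D , N′≤DN) x → ℝ.≤-trans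
      (maximal N′ invariant′ normalized′ (D , 0<D , λ y → ℝ.≤-trans (N′≤DN y)
        (ℝ.≤-reflexive (ℝ.*-congˡ (N≗N₀ y)))) x)
      (ℝ.≤-reflexive (ℝ.sym (N≗N₀ x)))

  -- The map from the universal unitary completion

  module _ (V̂ : UniversalUnitaryCompletion ρ v) (E : ExtensionOfInclusion ρ v N V̂) where
    private
      module V̂ = UniversalUnitaryCompletion V̂
      module V̂V = VectorSpaceProperties {K = K} V̂.space
      module V̂P = NormProperties V̂.norm
      module gN = Norm V̂.gaugeNorm
      module ι = IsModuleHomomorphism V̂.linear
      open ExtensionOfInclusion E using (I; continuous; extends) renaming (linear to I-linear)
      module I = IsModuleHomomorphism I-linear

    QuotientIsIsometric : Set ℓ
    QuotientIsIsometric = Surjective V̂._≈ᴹ_ _≈ᴹ_ I × InducesIsometryFromQuotient V̂.norm N I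

    I-− : ∀ x y → I (x V̂V.− y) ≈ᴹ I x − I y
    I-− x y = ≈ᴹ-trans (I.+ᴹ-homo x _) (+ᴹ-congˡ (I.-ᴹ-homo y))

    I-evalⱽ : ∀ xs → I (V̂.ι (evalⱽ xs)) ≈ᴹ eval xs
    I-evalⱽ xs = extends (evalⱽ xs)

    ι-dist : ∀ x y → V̂.dist (V̂.ι x) (V̂.ι y) ℝ.≈ gN.‖ x V.− y ‖
    ι-dist x y = begin-equality
      V̂.‖ V̂.ι x V̂V.− V̂.ι y ‖          ≈⟨ V̂.‖‖-cong (V̂V.+ᴹ-congˡ (ι.-ᴹ-homo y)) ⟨
      V̂.‖ V̂.ι x V̂V.+ᴹ V̂.ι (V.-ᴹ y) ‖  ≈⟨ V̂.‖‖-cong (ι.+ᴹ-homo x (V.-ᴹ y)) ⟨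
      V̂.‖ V̂.ι (x V.− y) ‖              ≈⟨ V̂.isometric (x V.− y) ⟩
      gN.‖ x V.− y ‖                   ∎

    module _ (normalized : IsNormalizedAt v N) (approximable : Approximable) where

      -- I is assumed only to be continuous. The bound holds on the dense image of V, where it is
      -- the maximality of the gauge, and continuity at x carries it over; η is small enough for
      -- both the continuity estimate and the error ε.
      I-nonexpansive : ∀ x → ‖ I x ‖ ≤ V̂.‖ x ‖
      I-nonexpansive x = ℝ.≤max-small⇒≤ (V̂.nonneg x) λ ε 0<ε →
        let δ , 0<δ , close = continuous x ε 0<ε
            η , 0<η , η≤δ , η≤ε = ℝ.common-lower 0<δ 0<ε
            l , ιl-x<η = V̂.dense x η 0<η
        in ‖x‖≤ {I x} {I (V̂.ι l)}
             (begin
               ‖ I (V̂.ι l) ‖                    ≈⟨ ‖‖-cong (extends l) ⟩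
               ‖ proj₁ l ‖                      ≤⟨ ‖‖≤gaugeNorm V̂.gaugeNorm V̂.isGaugeNorm N invariant (positive v≉0) l ⟩
               ‖ v ‖ ℝ.* gN.‖ l ‖               ≈⟨ ℝ.*-congʳ normalized ⟩
               1# ℝ.* gN.‖ l ‖                  ≈⟨ ℝ.*-identityˡ _ ⟩
               gN.‖ l ‖                         ≈⟨ V̂.isometric l ⟨
               V̂.‖ V̂.ι l ‖                      ≤⟨ V̂P.‖x‖≤max (V̂.ι l) x ⟩
               max V̂.‖ x ‖ (V̂.dist (V̂.ι l) x)   ≤⟨ ℝ.⊔-mono-≤ ℝ.≤-refl (ℝ.≤-trans (proj₁ ιl-x<η) η≤ε) ⟩
               max V̂.‖ x ‖ ε                    ∎)
             (ℝ.≤-trans (proj₁ (close (V̂.ι l) (ℝ.≤-<-trans (V̂P.dist-sym-≤ _ _) (ℝ.<-≤-trans ιl-x<η η≤δ))))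
               (ℝ.x≤y⊔x _ _))

      preimage : ∀ {w r} → ‖ w ‖ < r → ∃[ x ] (I x ≈ᴹ w × V̂.‖ x ‖ ≤ r)
      preimage {w} {r} ‖w‖<r = x , Ix≈w , ‖x‖≤r
        where
        open Expansion approximable ‖w‖<r

        s : ℕ → V̂.Carrierᴹ
        s n = V̂.ι (evalⱽ (sums n))

        step : ∀ n → V̂.dist (s (1+ n)) (s n) ≤ halving r n
        step n = ℝ.≤-trans (ℝ.≤-reflexive (ι-dist (evalⱽ (sums (1+ n))) (evalⱽ (sums n))))
          (gaugeNorm-≤ V̂.gaugeNorm V̂.isGaugeNorm {w = evalⱽ (sums (1+ n)) V.− evalⱽ (sums n)}
            (0≤halving n) (steps n) (steps-bounded n)
            (≈ᴹ-trans (−-cong (eval-++ (steps n) (sums n)) ≈ᴹ-refl) ([x+y]−y≈x _ _)))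

        limit : ∃[ x ] (∀ n → V̂.dist x (s n) ≤ halving r n)
        limit = V̂P.halving-steps-limit 0<r s step V̂.complete

        x : V̂.Carrierᴹ
        x = proj₁ limit

        ‖x‖≤r : V̂.‖ x ‖ ≤ r
        -- `s 0` comes from the empty combination, so the case n = 0 of the convergence rate already
        -- bounds x by r.
        ‖x‖≤r = V̂P.‖x‖≤ {x} {s 0}
          (ℝ.≤-trans (ℝ.≤-reflexive (V̂.isometric (evalⱽ [])))
            (gaugeNorm-≤ V̂.gaugeNorm V̂.isGaugeNorm {w = evalⱽ []} (proj₁ 0<r) [] [] ≈ᴹ-refl))
          (proj₂ limit 0)

        Ix≈w : I x ≈ᴹ w
        Ix≈w = dist-small⇒≈ λ ε 0<ε →
          let n , small = ℝ.halving-small r 0<r ε 0<ε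
          in ℝ.≤-trans (dist-≤ {I x} {eval (sums n)} {w}
               (begin
                 ‖ I x − eval (sums n) ‖     ≈⟨ ‖‖-cong (−-cong ≈ᴹ-refl (I-evalⱽ (sums n))) ⟨
                 ‖ I x − I (s n) ‖           ≈⟨ ‖‖-cong (I-− x (s n)) ⟨
                 ‖ I (x V̂V.− s n) ‖          ≤⟨ I-nonexpansive (x V̂V.− s n) ⟩
                 V̂.dist x (s n)              ≤⟨ proj₂ limit n ⟩
                 halving r n                 ∎)
               (ℝ.≤-trans (dist-sym-≤ _ _) (proj₁ (sums-close n)))) (proj₁ small)

      approximable⇒quotientIsIsometric : QuotientIsIsometric
      approximable⇒quotientIsIsometric = surjective , λ x → lower x , greatest x
        where
        surjective : Surjective V̂._≈ᴹ_ _≈ᴹ_ I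
        surjective w =
          let x , Ix≈w , _ = preimage (ℝ.x<x+1 ‖ w ‖)
          in x , λ z≈x → ≈ᴹ-trans (I.⟦⟧-cong z≈x) Ix≈w

        Coset : V̂.Carrierᴹ → ℝ.Carrier → Set ℓ
        Coset x t = ∃[ k ] (Kernel V̂.norm N I k × t ℝ.≈ V̂.‖ x V̂V.+ᴹ k ‖)

        lower : ∀ x → ℝ.IsLowerBound (Coset x) ‖ I x ‖
        lower x t (k , Ik≈0 , t≈) = begin
          ‖ I x ‖              ≈⟨ ‖‖-cong (≈ᴹ-trans (+ᴹ-congˡ Ik≈0) (+ᴹ-identityʳ (I x))) ⟨
          ‖ I x +ᴹ I k ‖       ≈⟨ ‖‖-cong (I.+ᴹ-homo x k) ⟨
          ‖ I (x V̂V.+ᴹ k) ‖    ≤⟨ I-nonexpansive _ ⟩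
          V̂.‖ x V̂V.+ᴹ k ‖      ≈⟨ t≈ ⟨
          t                    ∎

        -- Were b above ‖I x‖, a preimage y of `I x` with norm at most some r < b would differ from
        -- x by a kernel element, so b would not be a lower bound on the coset.
        greatest : ∀ x b → ℝ.IsLowerBound (Coset x) b → b ≤ ‖ I x ‖
        greatest x b lb = ℝ.≮⇒≥ λ ‖Ix‖<b →
          let r , ‖Ix‖<r , r<b = ℝ.between ‖Ix‖<b
              y , Iy≈Ix , ‖y‖≤r = preimage ‖Ix‖<r
              b≤‖y‖ = lb V̂.‖ y ‖ (y V̂V.− x , ≈ᴹ-trans (I-− y x) (x≈y⇒x-y≈0 Iy≈Ix) ,
                V̂.‖‖-cong (V̂V.≈ᴹ-sym (V̂V.y+[x−y]≈x y x)))
          in ℝ.<⇒≱ r<b (ℝ.≤-trans b≤‖y‖ ‖y‖≤r)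

    module _ (quotientIsIsometric : QuotientIsIsometric) where

      private
        surjective = proj₁ quotientIsIsometric
        isometry = proj₂ quotientIsIsometric

      isometry⇒nonexpansive : ∀ x → ‖ I x ‖ ≤ V̂.‖ x ‖
      isometry⇒nonexpansive x = proj₁ (isometry x) V̂.‖ x ‖
        (V̂V.0ᴹ , I.0ᴹ-homo , V̂.‖‖-cong (V̂V.≈ᴹ-sym (V̂V.+ᴹ-identityʳ x)))

      -- One element of V is close to x in V̂ and to w in B simultaneously, since I does not
      -- increase norms. The first closeness controls its gauge, the second the remaining error in
      -- B.
      approximate : ∀ {w x} → I x ≈ᴹ w → ∀ ε → 0# < ε →
                    ∃[ l ] (V̂.dist (V̂.ι l) x < ε × dist w (proj₁ l) < ε)
      approximate {w} {x} Ix≈w ε 0<ε =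
        let l , ιl-x<ε = V̂.dense x ε 0<ε
        in l , ιl-x<ε , (begin-strict
             ‖ w − proj₁ l ‖        ≈⟨ ‖‖-cong (−-cong Ix≈w (extends l)) ⟨
             ‖ I x − I (V̂.ι l) ‖    ≈⟨ ‖‖-cong (I-− x (V̂.ι l)) ⟨
             ‖ I (x V̂V.− V̂.ι l) ‖   ≤⟨ isometry⇒nonexpansive _ ⟩
             V̂.dist x (V̂.ι l)       ≤⟨ V̂P.dist-sym-≤ _ _ ⟩
             V̂.dist (V̂.ι l) x       <⟨ ιl-x<ε ⟩
             ε                      ∎)

      private
        v̂ : V̂.Carrierᴹ
        v̂ = V̂.ι vⱽ

        Iv̂≈v : I v̂ ≈ᴹ v
        Iv̂≈v = extends vⱽ

        -- If ‖v‖ < 1, then v would lift to an x with ‖x‖ < 1, hence be closer than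
        -- ‖v‖ to an element of V of gauge < 1, whose norm is less than ‖v‖.
        ‖v‖≮1 : ¬ ‖ v ‖ < 1#
        ‖v‖≮1 ‖v‖<1 =
          let 0<‖v‖ = positive v≉0
              t , (k , Ik≈0 , t≈) , t<1 = ℝ.inf-approx (isometry v̂)
                (ℝ.≤-<-trans (ℝ.≤-reflexive (‖‖-cong Iv̂≈v)) ‖v‖<1)
              x = v̂ V̂V.+ᴹ k
              Ix≈v = ≈ᴹ-trans (I.+ᴹ-homo v̂ k) (≈ᴹ-trans (+ᴹ-cong Iv̂≈v Ik≈0) (+ᴹ-identityʳ v))
              l , ιl-x< , v-l< = approximate Ix≈v ‖ v ‖ 0<‖v‖
              ‖ιl‖<1 = V̂P.‖x‖< {V̂.ι l} {x} (ℝ.≤-<-trans (ℝ.≤-reflexive (ℝ.sym t≈)) t<1) (ℝ.<-trans ιl-x< ‖v‖<1)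
              ‖l‖<‖v‖ = begin-strict
                ‖ proj₁ l ‖            ≤⟨ ‖‖≤gaugeNorm V̂.gaugeNorm V̂.isGaugeNorm N invariant 0<‖v‖ l ⟩
                ‖ v ‖ ℝ.* gN.‖ l ‖     ≈⟨ ℝ.*-congˡ (V̂.isometric l) ⟨
                ‖ v ‖ ℝ.* V̂.‖ V̂.ι l ‖  <⟨ ℝ.*-monoʳ-< 0<‖v‖ ‖ιl‖<1 ⟩
                ‖ v ‖ ℝ.* 1#           ≈⟨ ℝ.*-identityʳ _ ⟩
                ‖ v ‖                  ∎
          in ℝ.<⇒≱ (‖x‖< {v} {proj₁ l} ‖l‖<‖v‖ v-l<) ℝ.≤-refl

      quotientIsIsometric⇒normalized : IsNormalizedAt v N
      quotientIsIsometric⇒normalized = ℝ.antisym (begin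
        ‖ v ‖                        ≈⟨ ‖‖-cong Iv̂≈v ⟨
        ‖ I v̂ ‖                      ≤⟨ isometry⇒nonexpansive v̂ ⟩
        V̂.‖ v̂ ‖                      ≈⟨ V̂.isometric _ ⟩
        gN.‖ vⱽ ‖     ≤⟨ ‖v‖-gaugeNorm-≤1 V̂.gaugeNorm V̂.isGaugeNorm ⟩
        1#                           ∎) (ℝ.≮⇒≥ ‖v‖≮1)

      quotientIsIsometric⇒locallyMaximal : IsLocallyMaximalAt ρ v N
      quotientIsIsometric⇒locallyMaximal N′ invariant′ normalized′ (D , 0<D , N′≤DN) w = begin
        N′.‖ w ‖        ≤⟨ proj₂ (isometry x) N′.‖ w ‖ N′w-lower ⟩
        ‖ I x ‖         ≈⟨ ‖‖-cong Ix≈w ⟩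
        ‖ w ‖           ∎
        where
        module N′ = Norm N′
        module N′P = NormProperties N′

        x : V̂.Carrierᴹ
        x = proj₁ (surjective w)

        Ix≈w : I x ≈ᴹ w
        Ix≈w = proj₂ (surjective w) V̂V.≈ᴹ-refl

        N′-≤ : ∀ l → N′.‖ proj₁ l ‖ ≤ V̂.‖ V̂.ι l ‖
        N′-≤ l = begin
          N′.‖ proj₁ l ‖          ≤⟨ ‖‖≤gaugeNorm V̂.gaugeNorm V̂.isGaugeNorm N′ invariant′ (N′P.positive v≉0) l ⟩
          N′.‖ v ‖ ℝ.* gN.‖ l ‖   ≈⟨ ℝ.*-cong normalized′ (ℝ.sym (V̂.isometric l)) ⟩
          1# ℝ.* V̂.‖ V̂.ι l ‖      ≈⟨ ℝ.*-identityˡ _ ⟩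
          V̂.‖ V̂.ι l ‖             ∎

        -- Domination enters only through the error: D rescales the distance from w to the
        -- approximating element of V, and this term vanishes with ε. Hence a bound with an
        -- arbitrary D leads to an inequality with constant 1.
        N′w≤ : ∀ {y} → I y ≈ᴹ w → N′.‖ w ‖ ≤ V̂.‖ y ‖
        N′w≤ {y} Iy≈w = ℝ.≤max-small⇒≤ (V̂.nonneg y) λ ε 0<ε →
          let δ , 0<δ , Dδ<ε = ℝ.small-multiple D 0<ε
              η , 0<η , η≤δ , η≤ε = ℝ.common-lower 0<δ 0<ε
              l , ιl-y<η , w-l<η = approximate Iy≈w η 0<η
          in N′P.‖x‖≤ {w} {proj₁ l}
               (begin
                 N′.‖ proj₁ l ‖                   ≤⟨ N′-≤ l ⟩
                 V̂.‖ V̂.ι l ‖                      ≤⟨ V̂P.‖x‖≤max (V̂.ι l) y ⟩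
                 max V̂.‖ y ‖ (V̂.dist (V̂.ι l) y)   ≤⟨ ℝ.⊔-mono-≤ ℝ.≤-refl (ℝ.≤-trans (proj₁ ιl-y<η) η≤ε) ⟩
                 max V̂.‖ y ‖ ε                    ∎)
               (begin
                 N′.dist w (proj₁ l)     ≤⟨ N′≤DN _ ⟩
                 D ℝ.* dist w (proj₁ l)  ≤⟨ ℝ.*-monoʳ-≤ (proj₁ 0<D) (ℝ.≤-trans (proj₁ w-l<η) η≤δ) ⟩
                 D ℝ.* δ                 ≤⟨ proj₁ Dδ<ε ⟩
                 ε                       ≤⟨ ℝ.x≤y⊔x _ _ ⟩
                 max V̂.‖ y ‖ ε           ∎)

        N′w-lower : ∀ t → (∃[ k ] (Kernel V̂.norm N I k × t ℝ.≈ V̂.‖ x V̂V.+ᴹ k ‖)) → N′.‖ w ‖ ≤ t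
        N′w-lower t (k , Ik≈0 , t≈) = ℝ.≤-trans
          (N′w≤ (≈ᴹ-trans (I.+ᴹ-homo x k) (≈ᴹ-trans (+ᴹ-cong Ix≈w Ik≈0) (+ᴹ-identityʳ w))))
          (ℝ.≤-reflexive (ℝ.sym t≈))

  -- A model of V̂ and of the map I

  module Construction where

    gaugeNorm : Norm {K = K} V
    gaugeNorm = gauge N invariant

    isGaugeNorm : IsGaugeNorm ρ v gaugeNorm
    isGaugeNorm = gauge-isGaugeNorm N invariant

    module C = CauchyCompletion em gaugeNorm

    V̂ : UniversalUnitaryCompletion ρ v
    V̂ = record
      { gaugeNorm   = gaugeNorm
      ; isGaugeNorm = isGaugeNorm
      ; completion  = C.completion
      }

    module L = C.Lift N N-complete proj₁ inclusion-linear ‖ v ‖ (positive v≉0)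
      (‖‖≤gaugeNorm gaugeNorm isGaugeNorm N invariant (positive v≉0))

    extension : ExtensionOfInclusion ρ v N V̂
    extension = record
      { I          = L.lift
      ; linear     = L.lift-linear
      ; continuous = L.lift-continuous
      ; extends    = L.lift-const
      }

theorem3p5 : (∀ {a} → ExcludedMiddle a) →
  ∀ {ℓ : Level} (ℝ : RealNumbers ℓ) (p : ℕ) → Prime p →
  (Cp : ComplexPAdicNumbers ℝ p) (G : Group ℓ ℓ) →
  let open ComplexPAdicNumbers Cp using (ℂₚ) in
  (B : BanachRepresentation {K = ℂₚ} G) →
  let module B = BanachRepresentation B in
  (v : B.Carrierᴹ) → ¬ (v B.≈ᴹ B.0ᴹ) →
  TFAE₃
    (IsStronglyCyclic B.representation B.norm v × EqualsCanonicalNorm B.representation B.norm v)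
    ((V̂ : UniversalUnitaryCompletion B.representation v)
     (E : ExtensionOfInclusion B.representation v B.norm V̂) →
     let module V̂ = UniversalUnitaryCompletion V̂
         open ExtensionOfInclusion E using (I) in
     Surjective V̂._≈ᴹ_ B._≈ᴹ_ I × InducesIsometryFromQuotient V̂.norm B.norm I)
    (IsNormalizedAt v B.norm × IsLocallyMaximalAt B.representation v B.norm)
theorem3p5 em ℝ _ _ Cp G B v v≉0 =
  (λ (_ , canonical) V̂ E →
    let normalized , maximal = canonical⇒locallyMaximal canonical
    in approximable⇒quotientIsIsometric V̂ E normalized
         (ThickenedGauge.locallyMaximal⇒approximable normalized maximal)) ,
  -- The hypothesis ranges over all models of V̂ and I; it is applied to the constructed one.
  (λ isometric →
    let open Construction
        quotient = isometric V̂ extension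
    in quotientIsIsometric⇒normalized V̂ extension quotient ,
       quotientIsIsometric⇒locallyMaximal V̂ extension quotient) ,
  (λ (normalized , maximal) →
    approximable⇒stronglyCyclic normalized
      (ThickenedGauge.locallyMaximal⇒approximable normalized maximal) ,
    locallyMaximal⇒canonical normalized maximal)
  where
  open ComplexPAdicNumbers Cp using (ℂₚ-completion)
  module B = BanachRepresentation B
  open CyclicVectors em (IsFieldCompletion.complete ℂₚ-completion)
    B.representation B.norm B.invariant B.complete v v≉0
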